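{- Let $P$ be a finite poset, $\ell$ a positive integer, $u,v$ as in the context, and $R$ a restriction function on $P$ that is consistent with respect to $P\times[\ell]^v_u$. Then the map $\Phi$ defined in the context is a bijection from $\mathcal L_{P\times[\ell]}(u,v,R)$ onto $\mathcal A^{\hat B}(\Gamma(P,\hat R))$, and for every $f\in\mathcal L_{P\times[\ell]}(u,v,R)$, $$\Phi(\mathrm{Pro}(f))=\mathrm{TogPro}(\Phi(f)).$$
   Context: $P\times[\ell]=\{(p,i):p\in P,1\le i\le\ell\}$ with product order. $u,v:P\to\{0,\ldots,\ell\}$ satisfy $u(p)+v(p)\le\ell$, and $v(p_1)\le v(p_2)$, $u(p_1)\ge u(p_2)$ whenever $p_1\le_Pp_2$; $P\times[\ell]^v_u=\{(p,i): u(p)<i<\ell+1-v(p)\}$. The fiber of $p$ is $F_p=\{(p,i)\in P\times[\ell]^v_u\}$. A restriction function is a map $R$ from $P$ to nonempty finite subsets of $\mathbb Z$. A $P$-strict labeling with restriction $R$ is $f:P\times[\ell]^v_u\to\mathbb Z$ with $f(p_1,i)<f(p_2,i)$ whenever $p_1<_Pp_2$, $f(p,i_1)\le f(p,i_2)$ whenever $i_1\le i_2$, and $f(p,i)\in R(p)$; the set of these is $\mathcal L_{P\times[\ell]}(u,v,R)$. $R$ is consistent w.r.t. $P\times[\ell]^v_u$ if every $k\in R(p)$ equals $f(p,i)$ for some such $f$ and some $(p,i)\in P\times[\ell]^v_u$. $R(p)_{>k}$ (resp. $R(p)_{<k}$) is the smallest element of $R(p)$ greater than $k$ (resp. largest less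 than $k$). A label $f(p,i)$ is raisable (resp. lowerable) if there is $g\in\mathcal L_{P\times[\ell]}(u,v,R)$ with $g(p,i)>f(p,i)$ (resp. $<$) and $g(p',i')=f(p',i')$ for all $(p',i')\in P\times[\ell]^v_u$ with $p'\ne p$. The Bender–Knuth involution $\rho_k$ acts fiberwise: if $k\notin R(p)$ or $k=\max R(p)$, $F_p$ is unchanged; otherwise call free the raisable labels equal to $k$ and the lowerable labels equal to $R(p)_{>k}$ in $F_p$; if these read (in increasing $i$) $a$ copies of $k$ followed by $b$ copies of $R(p)_{>k}$, replace them by $b$ copies of $k$ followed by $a$ copies of $R(p)_{>k}$. Promotion is $\mathrm{Pro}=\cdots\circ\rho_2\circ\rho_1\circ\rho_0\circ\rho_{ -1}\circ\cdots$ (only finitely many $\rho_k$ act nontrivially). $\Gamma$: for a restriction function $R'$, let $R'(p)^*=R'(p)\setminus\{\max R'(p)\}$. $\Gamma(P,R')$ is the poset on $\{(p,k):p\in P,k\in R'(p)^*\}$ whose covering relations are $(p_1,k_1)\lessdot(p_2,k_2)$ iff either (1) $p_1=p_2$ and $k_1=R'(p_1)_{>k_2}$, or (2) $p_1\lessdot_Pp_2$, $k_1=R'(p_1)_{<k_2}\ne\max R'(p_1)$, and there is no $k\in R'(p_2)$ with $k>k_2$ and $R'(p_1)_{<k}=k_1$. $\hat R$: with $h(p)$ (resp. $\tilde h(p)$) the maximum number of elements of a chain of $P$ with largest (resp. smallest) element $p$, $\hat R(p)=R(p)\cup\{\min\bigcup_{q}R(q)-\tilde h(p),\ \max\bigcup_qR(q)+h(p)\}$.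 $Q$-partitions: for a finite poset $Q$, $W\subseteq Q$ containing all minimal and maximal elements of $Q$, and order-preserving $B:W\to\{0,\ldots,\ell\}$, $\mathcal A^B(Q)$ is the set of order-preserving $\sigma:Q\to\{0,\ldots,\ell\}$ with $\sigma|_W=B$; $W=\mathrm{dom}(B)$. For $x\in Q\setminus W$ the toggle $\tau_x$ changes only the value at $x$, to $\min\{\sigma(y):y\text{ covers }x\}+\max\{\sigma(z):z\text{ is covered by }x\}-\sigma(x)$. Here $\hat B$ has domain $\{(p,\min\hat R(p)^*),(p,\max\hat R(p)^*):p\in P\}$ in $\Gamma(P,\hat R)$, with $\hat B(p,\min\hat R(p)^*)=\ell-u(p)$ and $\hat B(p,\max\hat R(p)^*)=v(p)$. $\mathrm{TogPro}=\cdots\circ\tau_2\circ\tau_1\circ\tau_0\circ\tau_{ -1}\circ\cdots$ on $\mathcal A^{\hat B}(\Gamma(P,\hat R))$, where $\tau_k$ is the composition of the (pairwise commuting) toggles $\tau_{(p,k)}$ over all $p$ with $(p,k)\in\Gamma(P,\hat R)\setminus\mathrm{dom}(\hat B)$. $\Phi$: for $f\in\mathcal L_{P\times[\ell]}(u,v,R)$ define $\hat f$ on all of $P\times[\ell]$ by $\hat f(p,i)=\min\hat R(p)$ if $i\le u(p)$, $\hat f(p,i)=f(p,i)$ if $u(p)<i<\ell+1-v(p)$, $\hat f(p,i)=\max\hat R(p)$ if $i\ge\ell+1-v(p)$. For each $i$ let $\mathcal O_i=\{(p,k)\in\Gamma(P,\hat R): k\ge\hat f(p,i)\}$, an order ideal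 of $\Gamma(P,\hat R)$. Then $\Phi(f)(p,k)$ is the number of $i\in\{1,\ldots,\ell\}$ with $(p,k)\notin\mathcal O_i$, i.e. $\Phi(f)(p,k)=\#\{i\in\{1,\ldots,\ell\}:\hat f(p,i)>k\}$. -}

module Defs where

open import Data.Nat using (ℕ; zero; suc; _≤_; _<_; _≤ᵇ_; _<ᵇ_; _∸_; _⊓_; _⊔_)
import Data.Nat as ℕ
open import Data.Integer using (ℤ; +_) renaming (_<_ to _<ℤ_; _≤_ to _≤ℤ_)
import Data.Integer as ℤ
import Data.Integer.Properties as ℤP
open import Data.Fin using (Fin)
import Data.Fin.Properties as FinP
open import Data.Bool using (Bool; true; false; _∧_; _∨_; not; if_then_else_; T)
open import Data.Maybe using (Maybe; just; nothing; fromMaybe)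
open import Data.List using (List; []; _∷_; map; filterᵇ; length; concatMap; upTo; allFin; foldr; _∷ʳ_)
open import Data.Bool.ListAction using (any)
open import Data.List.NonEmpty using (List⁺; toList; foldr₁) renaming (_∷_ to _∷⁺_)
open import Data.List.Membership.Propositional using (_∈_)
open import Data.List.Relation.Unary.Linked using (Linked)
open import Data.Product using (Σ; ∃; _×_; _,_)
open import Relation.Nullary using (Dec; ¬_)
open import Relation.Nullary.Decidable using (⌊_⌋)
open import Relation.Binary.PropositionalEquality using (_≡_; _≢_)
open import Relation.Binary.Structures using (IsDecPartialOrder)
open import Relation.Binary.Construct.Closure.ReflexiveTransitive using (Star)

-- Finite subsets of ℤ are represented by nonempty lists (only membership,
-- min, max, successor and predecessor are ever used, so duplicates and
-- order of the list are irrelevant).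

maxL : List⁺ ℤ → ℤ
maxL = foldr₁ ℤ._⊔_

minL : List⁺ ℤ → ℤ
minL = foldr₁ ℤ._⊓_

_∈ᵇ_ : ℤ → List ℤ → Bool
k ∈ᵇ xs = any (λ x → ⌊ k ℤP.≟ x ⌋) xs

minMaybe : List ℤ → Maybe ℤ
minMaybe []       = nothing
minMaybe (x ∷ xs) = just (foldr ℤ._⊓_ x xs)

maxMaybe : List ℤ → Maybe ℤ
maxMaybe []       = nothing
maxMaybe (x ∷ xs) = just (foldr ℤ._⊔_ x xs)

succIn : List⁺ ℤ → ℤ → Maybe ℤ
succIn A k = minMaybe (filterᵇ (λ x → ⌊ k ℤP.<? x ⌋) (toList A))

predIn : List⁺ ℤ → ℤ → Maybe ℤ
predIn A k = maxMaybe (filterᵇ (λ x → ⌊ x ℤP.<? k ⌋) (toList A))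

_==ᵐ_ : Maybe ℤ → ℤ → Bool
just y  ==ᵐ x = ⌊ y ℤP.≟ x ⌋
nothing ==ᵐ x = false

-- min / max of a list of naturals; for nonempty lists these are the
-- honest min / max (the fallback value is only used for empty lists)
minℕ : ℕ → List ℕ → ℕ
minℕ d []       = d
minℕ d (x ∷ xs) = foldr _⊓_ x xs

maxℕ : List ℕ → ℕ
maxℕ = foldr _⊔_ 0

countᵇ : {A : Set} → (A → Bool) → List A → ℕ
countᵇ p xs = length (filterᵇ p xs)

range1 : ℕ → List ℕ
range1 m = map suc (upTo m)

module GammaDefs {n : ℕ} (leq : Fin n → Fin n → Bool) (R' : Fin n → List⁺ ℤ) where

  ltP : Fin n → Fin n → Bool
  ltP p q = leq p q ∧ not ⌊ p FinP.≟ q ⌋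

  coverP : Fin n → Fin n → Bool
  coverP p q = ltP p q ∧ not (any (λ r → ltP p r ∧ ltP r q) (allFin n))

  inΓ : Fin n × ℤ → Bool
  inΓ (p , k) = (k ∈ᵇ toList (R' p)) ∧ not ⌊ k ℤP.≟ maxL (R' p) ⌋

  coverΓ : Fin n × ℤ → Fin n × ℤ → Bool
  coverΓ (p₁ , k₁) (p₂ , k₂) =
    inΓ (p₁ , k₁) ∧ inΓ (p₂ , k₂) ∧
    ( (⌊ p₁ FinP.≟ p₂ ⌋ ∧ (succIn (R' p₁) k₂ ==ᵐ k₁))
    ∨ (coverP p₁ p₂ ∧ (predIn (R' p₁) k₂ ==ᵐ k₁)
        ∧ not ⌊ k₁ ℤP.≟ maxL (R' p₁) ⌋
        ∧ not (any (λ k → ⌊ k₂ ℤP.<? k ⌋ ∧ (predIn (R' p₁) k ==ᵐ k₁))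
                   (toList (R' p₂)))))

  _≤Γ_ : Fin n × ℤ → Fin n × ℤ → Set
  _≤Γ_ = Star (λ x y → T (coverΓ x y))

  Γlist : List (Fin n × ℤ)
  Γlist = concatMap (λ p → map (λ k → (p , k)) (filterᵇ (λ k → inΓ (p , k)) (toList (R' p))))
                    (allFin n)

  minStar maxStar : Fin n → ℤ
  minStar p = fromMaybe (maxL (R' p))
                (minMaybe (filterᵇ (λ k → not ⌊ k ℤP.≟ maxL (R' p) ⌋) (toList (R' p))))
  maxStar p = fromMaybe (maxL (R' p)) (predIn (R' p) (maxL (R' p)))

  allVals : List ℤ
  allVals = concatMap (λ p → toList (R' p)) (allFin n)

  -- min / max of ⋃_q R'(q)  (fallback 0 only when P is empty)
  minAll maxAll : ℤ
  minAll = fromMaybe (+ 0) (minMaybe allVals)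
  maxAll = fromMaybe (+ 0) (maxMaybe allVals)

record Setting : Set₁ where
  field
    n     : ℕ
    _≤P_  : Fin n → Fin n → Set
    isDPO : IsDecPartialOrder _≡_ _≤P_
    ℓ     : ℕ
    u v   : Fin n → ℕ
    R     : Fin n → List⁺ ℤ

  _<P_ : Fin n → Fin n → Set
  p <P q = p ≤P q × p ≢ q

  leqᵇ : Fin n → Fin n → Bool
  leqᵇ p q = ⌊ IsDecPartialOrder._≤?_ isDPO p q ⌋

-- Labelings are total functions Fin n → ℕ → ℤ, of which only the values on
-- P × [ℓ]^v_u matter.
Lab : Setting → Set
Lab S = Fin (Setting.n S) → ℕ → ℤ

module _ (S : Setting) where
  open Setting S

  InDom : Fin n → ℕ → Set
  InDom p i = u p < i × i < suc ℓ ∸ v p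

  InDomᵇ : Fin n → ℕ → Bool
  InDomᵇ p i = (u p <ᵇ i) ∧ (i <ᵇ suc ℓ ∸ v p)

  record IsLabeling (f : Lab S) : Set where
    field
      strictP : ∀ {p₁ p₂ i} → InDom p₁ i → InDom p₂ i → p₁ <P p₂ → f p₁ i <ℤ f p₂ i
      weakI   : ∀ {p i₁ i₂} → InDom p i₁ → InDom p i₂ → i₁ ≤ i₂ → f p i₁ ≤ℤ f p i₂
      restr   : ∀ {p i} → InDom p i → f p i ∈ toList (R p)

  Consistent : Set
  Consistent = ∀ p k → k ∈ toList (R p) →
    ∃ λ (f : Lab S) → IsLabeling f × ∃ λ i → InDom p i × f p i ≡ k

  AgreeOff : Fin n → Lab S → Lab S → Set
  AgreeOff p g f = ∀ p' i' → InDom p' i' → p' ≢ p → g p' i' ≡ f p' i'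

  Raisable Lowerable : Lab S → Fin n → ℕ → Set
  Raisable  f p i = ∃ λ (g : Lab S) → IsLabeling g × f p i <ℤ g p i × AgreeOff p g f
  Lowerable f p i = ∃ λ (g : Lab S) → IsLabeling g × g p i <ℤ f p i × AgreeOff p g f

  IsHeight : Fin n → ℕ → Set
  IsHeight p m =
    (∃ λ xs → Linked _<P_ (xs ∷ʳ p) × suc (length xs) ≡ m) ×
    (∀ xs → Linked _<P_ (xs ∷ʳ p) → suc (length xs) ≤ m)

  IsCoheight : Fin n → ℕ → Set
  IsCoheight p m =
    (∃ λ xs → Linked _<P_ (p ∷ xs) × suc (length xs) ≡ m) ×
    (∀ xs → Linked _<P_ (p ∷ xs) → suc (length xs) ≤ m)

  open GammaDefs leqᵇ R using () renaming (minAll to minR; maxAll to maxR)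

  -- Bender–Knuth involutions and promotion, given decision procedures for
  -- raisability / lowerability (the result does not depend on the choice
  -- of decision procedure, since Dec of a proposition is determined by it).
  module Promotion (raise? : ∀ f p i → Dec (Raisable f p i))
                   (lower? : ∀ f p i → Dec (Lowerable f p i)) where

    ρ : ℤ → Lab S → Lab S
    ρ k f p i =
      if active ∧ free i
        then (if rank ≤ᵇ b then k else fromMaybe k k⁺)
        else f p i
      where
        k⁺ : Maybe ℤ
        k⁺ = succIn (R p) k
        active : Bool
        active = (k ∈ᵇ toList (R p)) ∧ not ⌊ k ℤP.≟ maxL (R p) ⌋
        free : ℕ → Bool
        free j = InDomᵇ p j ∧
                 ( (⌊ f p j ℤP.≟ k ⌋ ∧ ⌊ raise? f p j ⌋)
                 ∨ ((k⁺ ==ᵐ f p j) ∧ ⌊ lower? f p j ⌋))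
        rank : ℕ
        rank = countᵇ free (range1 i)
        b : ℕ
        b = countᵇ (λ j → free j ∧ (k⁺ ==ᵐ f p j)) (range1 ℓ)

    ρs : ℤ → ℕ → Lab S → Lab S
    ρs k zero    f = f
    ρs k (suc t) f = ρs (k ℤ.+ + 1) t (ρ k f)

    -- all ρ_k with k outside [min ⋃R, max ⋃R] act trivially
    Pro : Lab S → Lab S
    Pro = ρs minR (suc ℤ.∣ maxR ℤ.- minR ∣)

  module Hat (h h̃ : Fin n → ℕ) where

    R̂ : Fin n → List⁺ ℤ
    R̂ p = (minR ℤ.- + h̃ p) ∷⁺ ((maxR ℤ.+ + h p) ∷ toList (R p))

    open GammaDefs leqᵇ R̂ public

    -- Q-partitions σ are total functions on Fin n × ℤ; only their values
    -- on Γ(P, R̂) matter.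
    QPart : Set
    QPart = Fin n × ℤ → ℕ

    record InA (σ : QPart) : Set where
      field
        bounded : ∀ x → T (inΓ x) → σ x ≤ ℓ
        mono    : ∀ x y → T (inΓ x) → T (inΓ y) → x ≤Γ y → σ x ≤ σ y
        bMin    : ∀ p → σ (p , minStar p) ≡ ℓ ∸ u p
        bMax    : ∀ p → σ (p , maxStar p) ≡ v p

    fhat : Lab S → Fin n → ℕ → ℤ
    fhat f p i =
      if i ≤ᵇ u p then minL (R̂ p)
      else if i <ᵇ suc ℓ ∸ v p then f p i
      else maxL (R̂ p)

    Φ : Lab S → QPart
    Φ f (p , k) = countᵇ (λ i → ⌊ k ℤP.<? fhat f p i ⌋) (range1 ℓ)

    toggle : Fin n × ℤ → QPart → QPart
    toggle (p , k) σ (q , j) =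
      if ⌊ q FinP.≟ p ⌋ ∧ ⌊ j ℤP.≟ k ⌋
        then (up ℕ.+ down) ∸ σ (p , k)
        else σ (q , j)
      where
        up   = minℕ ℓ (map σ (filterᵇ (λ y → coverΓ (p , k) y) Γlist))
        down = maxℕ   (map σ (filterᵇ (λ z → coverΓ z (p , k)) Γlist))

    τ : ℤ → QPart → QPart
    τ k σ = foldr (λ p σ' → if act p then toggle (p , k) σ' else σ') σ (allFin n)
      where
        act : Fin n → Bool
        act p = inΓ (p , k) ∧ not ⌊ k ℤP.≟ minStar p ⌋ ∧ not ⌊ k ℤP.≟ maxStar p ⌋

    τs : ℤ → ℕ → QPart → QPart
    τs k zero    σ = σ
    τs k (suc t) σ = τs (k ℤ.+ + 1) t (τ k σ)

    -- all τ_k with k outside [min ⋃R̂, max ⋃R̂] act trivially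
    TogPro : QPart → QPart
    TogPro = τs minAll (suc ℤ.∣ maxAll ℤ.- minAll ∣)

{-# OPTIONS --safe #-}
module Submission where

-- Write F = f̂.  F is weakly increasing along fibres and strictly increasing in P on all of
-- P × [ℓ], because R̂ puts the padding below and above every label of R.  Hence k < F(p,i) holds
-- exactly for the last Φ(f)(p,k) indices i; this gives injectivity, and the inverse sends σ to
-- F(p,i) = the least k ∈ R̂(p)* with i ≤ ℓ − σ(p,k), or max R̂(p) if there is none.
-- For equivariance let k ∈ R(p) have successor s in R(p), and let a (resp. b) be the number of
-- raisable k's (resp. lowerable s's) in the fibre of p.  Raising a k is obstructed exactly by a
-- label ≤ s in a cover of p, which makes the minimum of Φ(f) over the upper covers of (p,k) equal
-- to Φ(f)(p,k) + a; dually the maximum over the lower covers is Φ(f)(p,k) − b.  So the toggle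
-- produces Φ(f)(p,k) + a − b, which is what ρ_k does.

open import Defs
open import Data.Nat using (ℕ; zero; suc; _≤_; _<_; _+_; _∸_; _≤ᵇ_; _<ᵇ_; _⊓_; _⊔_; z≤n; s≤s; _≤?_; _<?_)
import Data.Nat.Properties as ℕP
open import Data.Integer using (ℤ; +_) renaming (_<_ to _<ℤ_; _≤_ to _≤ℤ_)
import Data.Integer as ℤ
import Data.Integer.Properties as ℤP
open import Data.Fin using (Fin)
import Data.Fin.Properties as FinP
open import Data.Bool using (Bool; true; false; _∧_; _∨_; not; if_then_else_; T; T?)
open import Data.Bool.ListAction using (any)
open import Data.Maybe using (just; fromMaybe)
open import Data.List using (List; []; _∷_; _++_; [_]; map; filterᵇ; filter; length; upTo; allFin; foldr; _∷ʳ_)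
import Data.List.Properties as ListP
open import Data.List.NonEmpty using (List⁺; toList; foldr₁) renaming (_∷_ to _∷⁺_)
open import Data.List.Membership.Propositional using (_∈_; _∉_; find; lose)
open import Data.List.Membership.Propositional.Properties using (∈-filter⁺; ∈-filter⁻; ∈-map⁺; ∈-map⁻; ∈-concatMap⁺; ∈-concatMap⁻; ∈-allFin)
open import Data.List.Relation.Unary.Any as Any using (Any; here; there)
open import Data.List.Relation.Unary.All as All using ()
open import Data.List.Relation.Unary.AllPairs using (_∷_)
open import Data.List.Relation.Unary.Linked using (Linked; [-]; _∷_)
open import Data.List.Relation.Unary.Unique.Propositional using (Unique)
open import Data.List.Relation.Unary.Unique.Propositional.Properties using (allFin⁺)
open import Data.Product using (∃; _×_; _,_; proj₁; proj₂)
open import Data.Sum using (_⊎_; inj₁; inj₂; [_,_]′)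
open import Data.Unit using (tt)
open import Algebra.Definitions using (Selective)
open import Algebra.Properties.AbelianGroup ℤP.+-0-abelianGroup using (∙-cancelˡ)
open import Function using (_∘_; flip)
open import Relation.Nullary using (Dec; yes; no; ¬_; does; contradiction)
open import Relation.Nullary.Decidable using (⌊_⌋; _×-dec_; _⊎-dec_; ¬?)
open import Relation.Nullary.Reflects using (Reflects; ofʸ; ofⁿ; _×-reflects_; _⊎-reflects_; ¬-reflects; T-reflects)
open import Relation.Unary using (Decidable)
open import Relation.Binary using (Rel; Reflexive; Transitive)
open import Relation.Binary.Structures using (IsDecPartialOrder)
open import Relation.Binary.PropositionalEquality using (_≡_; _≢_; refl; sym; trans; cong; cong₂; subst; subst₂; module ≡-Reasoning)
open import Relation.Binary.Construct.Closure.ReflexiveTransitive using (ε; _◅_)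
open import Level using (0ℓ)

-- A cover of Γ between two fibres encodes strictness along P. Let (p₁ , k₁) be covered by (p₂ , k₂)
-- with p₁ covered by p₂, and let s be the successor of k₁ in `R̂ p₁`. Having k₁ as predecessor in
-- `R̂ p₁` means k₁ < k₂ ≤ s, and the maximality clause makes k₂ the largest such element of
-- `R̂ p₂`. Hence σ(p₁,k₁) ≤ σ(p₂,k₂) says: wherever the label of p₁ is at least s, the label of p₂
-- exceeds s. This reading drives surjectivity and picks out the extremal covers in the toggle. The
-- toggle is computed with index sets rather than numbers. A bound over all covers is then an
-- inclusion of sets, its attainment is decided at one extremal index, and the truncated subtraction
-- of naturals enters only in the last line.

private variable
  A B : Set
  β : Bool

-- Reflection of the boolean definitions

isYes-reflects : (d : Dec A) → Reflects A ⌊ d ⌋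
isYes-reflects (yes a) = ofʸ a
isYes-reflects (no ¬a) = ofⁿ ¬a

reflects-map : Reflects A β → (A → B) → (B → A) → Reflects B β
reflects-map (ofʸ a)  f g = ofʸ (f a)
reflects-map (ofⁿ ¬a) f g = ofⁿ (¬a ∘ g)

T⇒ : Reflects A β → T β → A
T⇒ (ofʸ a) _ = a

⇒T : Reflects A β → A → T β
⇒T (ofʸ _)  _ = tt
⇒T (ofⁿ ¬a) a = ¬a a

if-yes : {x y : B} → Reflects A β → A → (if β then x else y) ≡ x
if-yes (ofʸ _)  _ = refl
if-yes (ofⁿ ¬a) a = contradiction a ¬a

if-no : {x y : B} → Reflects A β → ¬ A → (if β then x else y) ≡ y
if-no (ofʸ a) ¬a = contradiction a ¬a
if-no (ofⁿ _) _  = refl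

any-reflects : {P : A → Set} {p : A → Bool} → (∀ x → Reflects (P x) (p x)) →
  ∀ xs → Reflects (Any P xs) (any p xs)
any-reflects r []       = ofⁿ λ ()
any-reflects r (x ∷ xs) = reflects-map (r x ⊎-reflects any-reflects r xs) Any.fromSum Any.toSum

∈ᵇ-reflects : ∀ k xs → Reflects (k ∈ xs) (k ∈ᵇ xs)
∈ᵇ-reflects k = any-reflects (λ x → isYes-reflects (k ℤP.≟ x))

∈-filterᵇ⁺ : {P : A → Set} {p : A → Bool} → (∀ x → Reflects (P x) (p x)) →
  ∀ {x xs} → x ∈ xs → P x → x ∈ filterᵇ p xs
∈-filterᵇ⁺ {p = p} r x∈xs Px = ∈-filter⁺ (T? ∘ p) x∈xs (⇒T (r _) Px)

∈-filterᵇ⁻ : {P : A → Set} {p : A → Bool} → (∀ x → Reflects (P x) (p x)) →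
  ∀ {x} xs → x ∈ filterᵇ p xs → x ∈ xs × P x
∈-filterᵇ⁻ {p = p} r xs x∈ with ∈-filter⁻ (T? ∘ p) {xs = xs} x∈
... | x∈xs , Tpx = x∈xs , T⇒ (r _) Tpx

-- Extremal elements of lists

-- Kept abstract so that one proof serves minima and maxima: a maximum is a minimum for the flipped
-- order.
module Extremum {A : Set} (_≲_ : Rel A 0ℓ) (≲-refl : Reflexive _≲_) (≲-trans : Transitive _≲_)
  (_•_ : A → A → A) (•-≲ˡ : ∀ x y → (x • y) ≲ x) (•-≲ʳ : ∀ x y → (x • y) ≲ y)
  (•-sel : Selective _≡_ _•_) where

  IsExtremum : List A → A → Set
  IsExtremum xs m = m ∈ xs × (∀ {y} → y ∈ xs → m ≲ y)

  foldr-extremum : ∀ x xs → IsExtremum (x ∷ xs) (foldr _•_ x xs)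
  foldr-extremum x []       = here refl , λ { (here refl) → ≲-refl }
  foldr-extremum x (y ∷ xs) with foldr-extremum x xs
  ... | m∈ , m≲ = mem , bound
    where
    m : A
    m = foldr _•_ x xs
    weaken : ∀ {z} → z ∈ x ∷ xs → z ∈ x ∷ y ∷ xs
    weaken (here e)  = here e
    weaken (there e) = there (there e)
    mem : y • m ∈ x ∷ y ∷ xs
    mem with •-sel y m
    ... | inj₁ e = there (here e)
    ... | inj₂ e = subst (_∈ x ∷ y ∷ xs) (sym e) (weaken m∈)
    bound : ∀ {z} → z ∈ x ∷ y ∷ xs → (y • m) ≲ z
    bound (here refl)         = ≲-trans (•-≲ʳ y m) (m≲ (here refl))
    bound (there (here refl)) = •-≲ˡ y m
    bound (there (there z∈))  = ≲-trans (•-≲ʳ y m) (m≲ (there z∈))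

  foldr₁-extremum : ∀ xs → IsExtremum (toList xs) (foldr₁ _•_ xs)
  foldr₁-extremum (x ∷⁺ xs) = go x xs
    where
    go : ∀ x xs → IsExtremum (x ∷ xs) (foldr₁ _•_ (x ∷⁺ xs))
    go x []       = here refl , λ { (here refl) → ≲-refl }
    go x (y ∷ xs) with go y xs | •-sel x (foldr₁ _•_ (y ∷⁺ xs))
    ... | m∈ , m≲ | s = [ here , (λ e → there (subst (_∈ y ∷ xs) (sym e) m∈)) ]′ s
                      , λ { (here refl) → •-≲ˡ _ _ ; (there z∈) → ≲-trans (•-≲ʳ x _) (m≲ z∈) }

  extremum-of : {P : A → Set} → Decidable P → ∀ {x xs} → x ∈ xs → P x →
    ∃ λ m → m ∈ xs × P m × (∀ {y} → y ∈ xs → P y → m ≲ y)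
  extremum-of P? {xs = xs} x∈ Px with filter P? xs in eq
  ... | [] = contradiction (subst (_ ∈_) eq (∈-filter⁺ P? x∈ Px)) λ ()
  ... | z ∷ zs with foldr-extremum z zs
  ...   | m∈ , m≲ with ∈-filter⁻ P? {xs = xs} (subst (_ ∈_) (sym eq) m∈)
  ...     | m∈xs , Pm = _ , m∈xs , Pm , λ y∈ Py → m≲ (subst (_ ∈_) eq (∈-filter⁺ P? y∈ Py))

module Minℤ = Extremum _≤ℤ_ ℤP.≤-refl ℤP.≤-trans ℤ._⊓_ ℤP.i⊓j≤i ℤP.i⊓j≤j ℤP.⊓-sel
module Maxℤ = Extremum (flip _≤ℤ_) ℤP.≤-refl (flip ℤP.≤-trans) ℤ._⊔_ ℤP.i≤i⊔j ℤP.i≤j⊔i ℤP.⊔-sel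
module Minℕ = Extremum _≤_ ℕP.≤-refl ℕP.≤-trans _⊓_ ℕP.m⊓n≤m ℕP.m⊓n≤n ℕP.⊓-sel
module Maxℕ = Extremum (flip _≤_) ℕP.≤-refl (flip ℕP.≤-trans) _⊔_ ℕP.m≤m⊔n ℕP.m≤n⊔m ℕP.⊔-sel

-- Attainment makes the list nonempty, so the fallback `d` is never returned.
minℕ-unique : ∀ {m} d xs → (∀ {x} → x ∈ xs → m ≤ x) → ∃ (λ x → x ∈ xs × x ≤ m) → minℕ d xs ≡ m
minℕ-unique d (x ∷ xs) m≤ (y , y∈ , y≤m) =
  ℕP.≤-antisym (ℕP.≤-trans (proj₂ (Minℕ.foldr-extremum x xs) y∈) y≤m)
               (m≤ (proj₁ (Minℕ.foldr-extremum x xs)))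

-- `maxℕ` folds from 0, so the value 0 needs no attaining element; this happens when `Down` contains
-- no index.
maxℕ-unique : ∀ {m} xs → (∀ {x} → x ∈ xs → x ≤ m) → m ≡ 0 ⊎ ∃ (λ x → x ∈ xs × m ≤ x) → maxℕ xs ≡ m
maxℕ-unique {m} xs ≤m m≤ = ℕP.≤-antisym upper (lower m≤)
  where
  upper : maxℕ xs ≤ m
  upper with proj₁ (Maxℕ.foldr-extremum 0 xs)
  ... | here e   = subst (_≤ m) (sym e) z≤n
  ... | there x∈ = ≤m x∈
  lower : m ≡ 0 ⊎ ∃ (λ x → x ∈ xs × m ≤ x) → m ≤ maxℕ xs
  lower (inj₁ refl)           = z≤n
  lower (inj₂ (x , x∈ , m≤x)) = ℕP.≤-trans m≤x (proj₂ (Maxℕ.foldr-extremum 0 xs) (there x∈))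

minMaybe-reflects : ∀ xs s → Reflects (Minℤ.IsExtremum xs s) (minMaybe xs ==ᵐ s)
minMaybe-reflects []       s = ofⁿ λ ()
minMaybe-reflects (x ∷ xs) s with Minℤ.foldr-extremum x xs
... | m∈ , m≤ = reflects-map (isYes-reflects (_ ℤP.≟ s))
    (λ { refl → m∈ , m≤ }) (λ (s∈ , s≤) → ℤP.≤-antisym (m≤ s∈) (s≤ m∈))

maxMaybe-reflects : ∀ xs s → Reflects (Maxℤ.IsExtremum xs s) (maxMaybe xs ==ᵐ s)
maxMaybe-reflects []       s = ofⁿ λ ()
maxMaybe-reflects (x ∷ xs) s with Maxℤ.foldr-extremum x xs
... | m∈ , ≤m = reflects-map (isYes-reflects (_ ℤP.≟ s))
    (λ { refl → m∈ , ≤m }) (λ (s∈ , ≤s) → ℤP.≤-antisym (≤s m∈) (≤m s∈))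

fromMaybe-==ᵐ : ∀ {d s} m → T (m ==ᵐ s) → fromMaybe d m ≡ s
fromMaybe-==ᵐ {s = s} (just x) e = T⇒ (isYes-reflects (x ℤP.≟ s)) e

-- Successors and predecessors in a finite set of integers

IsSucc IsPred : List ℤ → ℤ → ℤ → Set
IsSucc xs k s = s ∈ xs × k <ℤ s × (∀ {x} → x ∈ xs → k <ℤ x → s ≤ℤ x)
IsPred xs k s = s ∈ xs × s <ℤ k × (∀ {x} → x ∈ xs → x <ℤ k → x ≤ℤ s)

succIn-reflects : ∀ xs k s → Reflects (IsSucc (toList xs) k s) (succIn xs k ==ᵐ s)
succIn-reflects xs k s = reflects-map (minMaybe-reflects _ s)
  (λ (s∈ , s≤) → let (s∈xs , k<s) = ∈-filterᵇ⁻ k<?-reflects (toList xs) s∈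
                 in s∈xs , k<s , λ x∈ k<x → s≤ (∈-filterᵇ⁺ k<?-reflects x∈ k<x))
  (λ (s∈ , k<s , s≤) → ∈-filterᵇ⁺ k<?-reflects s∈ k<s
                     , λ y∈ → let (y∈xs , k<y) = ∈-filterᵇ⁻ k<?-reflects (toList xs) y∈ in s≤ y∈xs k<y)
  where
  k<?-reflects : ∀ x → Reflects (k <ℤ x) ⌊ k ℤP.<? x ⌋
  k<?-reflects x = isYes-reflects (k ℤP.<? x)

predIn-reflects : ∀ xs k s → Reflects (IsPred (toList xs) k s) (predIn xs k ==ᵐ s)
predIn-reflects xs k s = reflects-map (maxMaybe-reflects _ s)
  (λ (s∈ , ≤s) → let (s∈xs , s<k) = ∈-filterᵇ⁻ <?k-reflects (toList xs) s∈
                 in s∈xs , s<k , λ x∈ x<k → ≤s (∈-filterᵇ⁺ <?k-reflects x∈ x<k))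
  (λ (s∈ , s<k , ≤s) → ∈-filterᵇ⁺ <?k-reflects s∈ s<k
                     , λ y∈ → let (y∈xs , y<k) = ∈-filterᵇ⁻ <?k-reflects (toList xs) y∈ in ≤s y∈xs y<k)
  where
  <?k-reflects : ∀ x → Reflects (x <ℤ k) ⌊ x ℤP.<? k ⌋
  <?k-reflects x = isYes-reflects (x ℤP.<? k)

succ-exists : ∀ {xs k x} → x ∈ xs → k <ℤ x → ∃ (IsSucc xs k)
succ-exists {k = k} x∈ k<x = Minℤ.extremum-of (k ℤP.<?_) x∈ k<x

pred-exists : ∀ {xs k x} → x ∈ xs → x <ℤ k → ∃ (IsPred xs k)
pred-exists {k = k} x∈ x<k = Maxℤ.extremum-of (ℤP._<? k) x∈ x<k

succ-unique : ∀ {xs k s t} → IsSucc xs k s → IsSucc xs k t → s ≡ t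
succ-unique (s∈ , k<s , s≤) (t∈ , k<t , t≤) = ℤP.≤-antisym (s≤ t∈ k<t) (t≤ s∈ k<s)

-- Counting

-- Recursion from the top index lets inductions peel off the last index, and makes `# P? i` the rank
-- of i whenever i satisfies P.
# : {P : ℕ → Set} → Decidable P → ℕ → ℕ
# P? zero    = 0
# P? (suc m) = if does (P? (suc m)) then suc (# P? m) else # P? m

module _ {P : ℕ → Set} (P? : Decidable P) where

  countᵇ-range1 : {p : ℕ → Bool} → (∀ i → Reflects (P i) (p i)) → ∀ m → countᵇ p (range1 m) ≡ # P? m
  countᵇ-range1 {p} r zero    = refl
  countᵇ-range1 {p} r (suc m) = begin
    countᵇ p (range1 (suc m))            ≡⟨ cong (countᵇ p ∘ map suc) (ListP.upTo-∷ʳ m) ⟨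
    countᵇ p (map suc (upTo m ∷ʳ m))     ≡⟨ cong (countᵇ p) (ListP.map-++ suc (upTo m) [ m ]) ⟩
    countᵇ p (range1 m ∷ʳ suc m)         ≡⟨ cong length (ListP.filter-++ (T? ∘ p) (range1 m) [ suc m ]) ⟩
    length (filterᵇ p (range1 m) ++ filterᵇ p [ suc m ]) ≡⟨ ListP.length-++ (filterᵇ p (range1 m)) ⟩
    countᵇ p (range1 m) + countᵇ p [ suc m ] ≡⟨ cong (_+ countᵇ p [ suc m ]) (countᵇ-range1 r m) ⟩
    # P? m + countᵇ p [ suc m ]          ≡⟨ last ⟩
    # P? (suc m) ∎
    where
    open ≡-Reasoning
    last : # P? m + countᵇ p [ suc m ] ≡ # P? (suc m)
    last with p (suc m) | r (suc m) | P? (suc m)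
    ... | true  | ofʸ _  | yes _  = ℕP.+-comm (# P? m) 1
    ... | true  | ofʸ a  | no ¬a  = contradiction a ¬a
    ... | false | ofⁿ ¬a | yes a  = contradiction a ¬a
    ... | false | ofⁿ _  | no _   = ℕP.+-identityʳ _

  #≡0 : ∀ m → (∀ {i} → 1 ≤ i → i ≤ m → ¬ P i) → # P? m ≡ 0
  #≡0 zero    ¬P = refl
  #≡0 (suc m) ¬P with P? (suc m)
  ... | yes a = contradiction a (¬P (s≤s z≤n) ℕP.≤-refl)
  ... | no _  = #≡0 m λ 1≤i i≤m → ¬P 1≤i (ℕP.m≤n⇒m≤1+n i≤m)

  -- Supplies the critical index at which a cover attains its bound: the last index outside `Up`
  -- and, through `first-success`, the first index in `Down`.
  last-failure : ∀ m → (∀ {i} → 1 ≤ i → i ≤ m → P i) ⊎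
    ∃ λ i₀ → ¬ P i₀ × (∀ {i} → i₀ < i → i ≤ m → P i)
  last-failure zero    = inj₁ λ 1≤i i≤0 → contradiction (ℕP.≤-trans 1≤i i≤0) λ ()
  last-failure (suc m) with P? (suc m)
  ... | no ¬a = inj₂ (suc m , ¬a , λ m<i i≤m → contradiction i≤m (ℕP.<⇒≱ m<i))
  ... | yes a with last-failure m
  ...   | inj₁ all = inj₁ λ {i} 1≤i i≤m → [ all 1≤i ∘ ℕP.≤-pred , (λ { refl → a }) ]′ (ℕP.m≤n⇒m<n∨m≡n i≤m)
  ...   | inj₂ (i₀ , ¬b , after) =
    inj₂ (i₀ , ¬b , λ {i} i₀<i i≤m → [ after i₀<i ∘ ℕP.≤-pred , (λ { refl → a }) ]′ (ℕP.m≤n⇒m<n∨m≡n i≤m))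

  first-success : ∀ m → (∀ {i} → 1 ≤ i → i ≤ m → ¬ P i) ⊎
    ∃ λ i₀ → P i₀ × (∀ {i} → 1 ≤ i → P i → i₀ ≤ i)
  first-success zero    = inj₁ λ 1≤i i≤0 → contradiction (ℕP.≤-trans 1≤i i≤0) λ ()
  first-success (suc m) with first-success m
  ... | inj₂ found = inj₂ found
  ... | inj₁ none with P? (suc m)
  ...   | yes a = inj₂ (suc m , a , λ 1≤i Pi → ℕP.≰⇒> (λ i≤m → none 1≤i i≤m Pi))
  ...   | no ¬a = inj₁ λ {i} 1≤i i≤m → [ none 1≤i ∘ ℕP.≤-pred , (λ { refl → ¬a }) ]′ (ℕP.m≤n⇒m<n∨m≡n i≤m)

  -- Successive indices satisfying P have ranks 1, 2, 3, ..., so the predicate keeps the first b of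
  -- them. These are the positions that `ρ` sets to k.
  #-rank : ∀ b m → # (λ i → P? i ×-dec (# P? i ≤? b)) m ≡ b ⊓ # P? m
  #-rank b zero    = sym (ℕP.⊓-zeroʳ b)
  #-rank b (suc m) with P? (suc m)
  ... | no _  = #-rank b m
  -- Index suc m has rank `suc (# P? m)`, and comparing this with b unfolds to `# P? m <ᵇ b`.
  ... | yes _ with # P? m <ᵇ b | ℕP.<ᵇ-reflects-< (# P? m) b
  ...   | true  | ofʸ r≤b = trans (cong suc (trans (#-rank b m) (ℕP.m≥n⇒m⊓n≡n (ℕP.<⇒≤ r≤b)))) (sym (ℕP.m≥n⇒m⊓n≡n r≤b))
  ...   | false | ofⁿ r≰b = trans (#-rank b m)
      (trans (ℕP.m≤n⇒m⊓n≡m (ℕP.≤-pred (ℕP.≰⇒> r≰b))) (sym (ℕP.m≤n⇒m⊓n≡m (ℕP.<⇒≤ (ℕP.≰⇒> r≰b)))))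

module _ {P Q : ℕ → Set} (P? : Decidable P) (Q? : Decidable Q) where

  #-mono : ∀ m → (∀ {i} → 1 ≤ i → i ≤ m → P i → Q i) → # P? m ≤ # Q? m
  #-mono zero    P⇒Q = z≤n
  #-mono (suc m) P⇒Q with P? (suc m) | Q? (suc m) | #-mono m (λ 1≤i i≤m → P⇒Q 1≤i (ℕP.m≤n⇒m≤1+n i≤m))
  ... | yes _ | yes _ | ih = s≤s ih
  ... | yes a | no ¬b | ih = contradiction (P⇒Q (s≤s z≤n) ℕP.≤-refl a) ¬b
  ... | no _  | yes _ | ih = ℕP.m≤n⇒m≤1+n ih
  ... | no _  | no _  | ih = ih

  #-mono-< : ∀ m → (∀ {i} → 1 ≤ i → i ≤ m → P i → Q i) →
    ∀ {i} → 1 ≤ i → i ≤ m → ¬ P i → Q i → # P? m < # Q? m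
  #-mono-< zero    P⇒Q 1≤i i≤m ¬Pi Qi = contradiction (ℕP.≤-trans 1≤i i≤m) λ ()
  #-mono-< (suc m) P⇒Q {i} 1≤i i≤m ¬Pi Qi with P? (suc m) | Q? (suc m) | ℕP.m≤n⇒m<n∨m≡n i≤m
  ... | yes a | no ¬b | _         = contradiction (P⇒Q (s≤s z≤n) ℕP.≤-refl a) ¬b
  ... | yes a | _     | inj₂ refl = contradiction a ¬Pi
  ... | no _  | no ¬b | inj₂ refl = contradiction Qi ¬b
  ... | no _  | yes _ | inj₂ refl = s≤s (#-mono m (λ 1≤i i≤m → P⇒Q 1≤i (ℕP.m≤n⇒m≤1+n i≤m)))
  ... | yes _ | yes _ | inj₁ i<m  = s≤s (#-mono-< m (λ 1≤i i≤m → P⇒Q 1≤i (ℕP.m≤n⇒m≤1+n i≤m)) 1≤i (ℕP.≤-pred i<m) ¬Pi Qi)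
  ... | no _  | yes _ | inj₁ i<m  = ℕP.m≤n⇒m≤1+n (#-mono-< m (λ 1≤i i≤m → P⇒Q 1≤i (ℕP.m≤n⇒m≤1+n i≤m)) 1≤i (ℕP.≤-pred i<m) ¬Pi Qi)
  ... | no _  | no _  | inj₁ i<m  = #-mono-< m (λ 1≤i i≤m → P⇒Q 1≤i (ℕP.m≤n⇒m≤1+n i≤m)) 1≤i (ℕP.≤-pred i<m) ¬Pi Qi

  #-split : ∀ m → # P? m ≡ # (λ i → P? i ×-dec Q? i) m + # (λ i → P? i ×-dec ¬? (Q? i)) m
  #-split zero    = refl
  #-split (suc m) with P? (suc m) | Q? (suc m)
  ... | yes _ | yes _ = cong suc (#-split m)
  ... | yes _ | no _  = trans (cong suc (#-split m)) (sym (ℕP.+-suc _ _))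
  ... | no _  | yes _ = #-split m
  ... | no _  | no _  = #-split m

#-cong : {P Q : ℕ → Set} (P? : Decidable P) (Q? : Decidable Q) → ∀ m →
  (∀ {i} → 1 ≤ i → i ≤ m → (P i → Q i) × (Q i → P i)) → # P? m ≡ # Q? m
#-cong P? Q? m P⇔Q = ℕP.≤-antisym (#-mono P? Q? m λ 1≤i i≤m → proj₁ (P⇔Q 1≤i i≤m))
                                  (#-mono Q? P? m λ 1≤i i≤m → proj₂ (P⇔Q 1≤i i≤m))

#-threshold : ∀ t m → # (t <?_) m ≡ m ∸ t
#-threshold t zero    = sym (ℕP.0∸n≡0 t)
#-threshold t (suc m) with t <ᵇ suc m | ℕP.<ᵇ-reflects-< t (suc m)
... | true  | ofʸ t<1+m = trans (cong suc (#-threshold t m)) (sym (ℕP.+-∸-assoc 1 (ℕP.≤-pred t<1+m)))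
... | false | ofⁿ t≮1+m = trans (#-threshold t m) (trans (ℕP.m≤n⇒m∸n≡0 (ℕP.<⇒≤ (ℕP.≮⇒≥ t≮1+m)))
                                                 (sym (ℕP.m≤n⇒m∸n≡0 (ℕP.≮⇒≥ t≮1+m))))

-- Upper sets of indices are nested, so their sizes determine them. If i were in P but not in Q,
-- every member of Q would lie above i and hence in P, and Q would be strictly smaller.
#-upset-⊆ : {P Q : ℕ → Set} (P? : Decidable P) (Q? : Decidable Q) →
  (∀ {i j} → i ≤ j → P i → P j) → (∀ {i j} → i ≤ j → Q i → Q j) →
  ∀ {m} → # P? m ≡ # Q? m → ∀ {i} → 1 ≤ i → i ≤ m → P i → Q i
#-upset-⊆ P? Q? P↑ Q↑ {m} eq {i} 1≤i i≤m Pi with Q? i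
... | yes Qi = Qi
... | no ¬Qi = contradiction (#-mono-< Q? P? m Q⇒P 1≤i i≤m ¬Qi Pi) (ℕP.<-irrefl (sym eq))
  where
  Q⇒P : ∀ {j} → 1 ≤ j → j ≤ m → _ → _
  Q⇒P {j} _ _ Qj with i ≤? j
  ... | yes i≤j = P↑ i≤j Pi
  ... | no i≰j  = contradiction (Q↑ (ℕP.<⇒≤ (ℕP.≰⇒> i≰j)) Qj) ¬Qi

i+∣j-i∣≡j : ∀ {i j} → i ≤ℤ j → i ℤ.+ + ℤ.∣ j ℤ.- i ∣ ≡ j
i+∣j-i∣≡j {i} {j} i≤j = begin
  i ℤ.+ + ℤ.∣ j ℤ.- i ∣    ≡⟨ cong (λ d → i ℤ.+ d) (ℤP.0≤i⇒+∣i∣≡i (ℤP.i≤j⇒0≤j-i i≤j)) ⟩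
  i ℤ.+ (j ℤ.- i)          ≡⟨ cong (λ d → i ℤ.+ d) (ℤP.+-comm j (ℤ.- i)) ⟩
  i ℤ.+ (ℤ.- i ℤ.+ j)      ≡⟨ ℤP.+-assoc i (ℤ.- i) j ⟨
  (i ℤ.- i) ℤ.+ j          ≡⟨ cong (ℤ._+ j) (ℤP.+-inverseʳ i) ⟩
  + 0 ℤ.+ j                ≡⟨ ℤP.+-identityˡ j ⟩
  j                        ∎
  where open ≡-Reasoning

-- Covers and heights in a finite poset

Linked-∷ʳ : {R : Rel A 0ℓ} → ∀ xs {x y} → Linked R (xs ∷ʳ x) → R x y → Linked R ((xs ∷ʳ x) ∷ʳ y)
Linked-∷ʳ []           [-]     r = r ∷ [-]
Linked-∷ʳ (_ ∷ [])     (e ∷ l) r = e ∷ Linked-∷ʳ [] l r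
Linked-∷ʳ (_ ∷ z ∷ zs) (e ∷ l) r = e ∷ Linked-∷ʳ (z ∷ zs) l r

module PosetFacts (S : Setting) where
  open Setting S
  module ≤P = IsDecPartialOrder isDPO

  _<P?_ : ∀ p q → Dec (p <P q)
  p <P? q = (p ≤P.≤? q) ×-dec ¬? (p FinP.≟ q)

  ≤P⇒<P⊎≡ : ∀ {p q} → p ≤P q → p <P q ⊎ p ≡ q
  ≤P⇒<P⊎≡ {p} {q} p≤q with p FinP.≟ q
  ... | yes p≡q = inj₂ p≡q
  ... | no p≢q  = inj₁ (p≤q , p≢q)

  _⋖_ : Fin n → Fin n → Set
  p ⋖ q = p <P q × ¬ Any (λ r → p <P r × r <P q) (allFin n)

  module _ (R' : Fin n → List⁺ ℤ) where
    open GammaDefs leqᵇ R' using (ltP; coverP; allVals; minAll; maxAll)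

    ltP-reflects : ∀ p q → Reflects (p <P q) (ltP p q)
    ltP-reflects p q = isYes-reflects (p ≤P.≤? q) ×-reflects ¬-reflects (isYes-reflects (p FinP.≟ q))

    coverP-reflects : ∀ p q → Reflects (p ⋖ q) (coverP p q)
    coverP-reflects p q = ltP-reflects p q ×-reflects
      ¬-reflects (any-reflects (λ r → ltP-reflects p r ×-reflects ltP-reflects r q) (allFin n))

    ∈-allVals : ∀ {p k} → k ∈ toList (R' p) → k ∈ allVals
    ∈-allVals {p} k∈ = ∈-concatMap⁺ (λ p → toList (R' p)) (lose (∈-allFin p) k∈)

    minAll-≤ : ∀ {p k} → k ∈ toList (R' p) → minAll ≤ℤ k
    minAll-≤ k∈ with allVals | ∈-allVals k∈
    ... | x ∷ xs | k∈xs = proj₂ (Minℤ.foldr-extremum x xs) k∈xs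

    ≤-maxAll : ∀ {p k} → k ∈ toList (R' p) → k ≤ℤ maxAll
    ≤-maxAll k∈ with allVals | ∈-allVals k∈
    ... | x ∷ xs | k∈xs = proj₂ (Maxℤ.foldr-extremum x xs) k∈xs

  module Heights (h h̃ : Fin n → ℕ) (isHeight : ∀ p → IsHeight S p (h p))
                 (isCoheight : ∀ p → IsCoheight S p (h̃ p)) where

    1≤h : ∀ p → 1 ≤ h p
    1≤h p = proj₂ (isHeight p) [] [-]

    1≤h̃ : ∀ p → 1 ≤ h̃ p
    1≤h̃ p = proj₂ (isCoheight p) [] [-]

    h-mono : ∀ {p q} → p <P q → h p < h q
    h-mono {p} {q} p<q with isHeight p
    ... | (xs , linked , len) , _ = ℕP.≤-trans
      (ℕP.≤-reflexive (cong suc (trans (sym len) (sym (trans (ListP.length-++ xs) (ℕP.+-comm _ 1))))))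
      (proj₂ (isHeight q) (xs ∷ʳ p) (Linked-∷ʳ xs linked p<q))

    h̃-anti : ∀ {p q} → p <P q → h̃ q < h̃ p
    h̃-anti {p} {q} p<q with isCoheight q
    ... | (xs , linked , len) , _ = subst (λ m → suc m ≤ h̃ p) len (proj₂ (isCoheight p) (q ∷ xs) (p<q ∷ linked))

    -- The height gap is the induction measure: since `h` is strictly increasing, an element
    -- strictly between p and q leaves a smaller gap on both sides.
    cover-induction : (C : Fin n → Fin n → Set) → Transitive C → (∀ {p q} → p ⋖ q → C p q) →
      ∀ {p q} → p <P q → C p q
    cover-induction C C-trans C-cover {p} {q} p<q = go (h q) (ℕP.m≤n+m (h q) (h p)) p<q
      where
      go : ∀ m {p q} → h q ≤ h p + m → p <P q → C p q
      go zero    {p} {q} hq≤ p<q = contradiction (h-mono p<q) (ℕP.≤⇒≯ (subst (h q ≤_) (ℕP.+-identityʳ (h p)) hq≤))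
      go (suc m) {p} {q} hq≤ p<q with Any.any? (λ r → (p <P? r) ×-dec (r <P? q)) (allFin n)
      ... | no none  = C-cover (p<q , none)
      ... | yes some with find some
      ...   | r , _ , p<r , r<q = C-trans (go m hr≤ p<r) (go m (ℕP.≤-trans hq≤′ (ℕP.+-monoˡ-≤ m (h-mono p<r))) r<q)
        where
        hq≤′ : h q ≤ suc (h p + m)
        hq≤′ = subst (h q ≤_) (ℕP.+-suc (h p) m) hq≤
        hr≤ : h r ≤ h p + m
        hr≤ = ℕP.≤-pred (ℕP.≤-trans (h-mono r<q) hq≤′)

    -- Moves an obstruction found anywhere above or below p to a cover of p, where Γ can see it. The
    -- weak inequalities on the far side make the relation transitive.
    cover-between : ∀ {p q} → p <P q → (∃ λ r → p ⋖ r × r ≤P q) × (∃ λ r → p ≤P r × r ⋖ q)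
    cover-between = cover-induction (λ p q → (∃ λ r → p ⋖ r × r ≤P q) × (∃ λ r → p ≤P r × r ⋖ q))
      (λ ((r , p⋖r , r≤q) , (s , p≤s , s⋖q)) ((r′ , q⋖r′ , r′≤t) , (s′ , q≤s′ , s′⋖t)) →
        (r , p⋖r , ≤P.trans r≤q (≤P.trans (proj₁ (proj₁ q⋖r′)) r′≤t)) ,
        (s′ , ≤P.trans p≤s (≤P.trans (proj₁ (proj₁ s⋖q)) q≤s′) , s′⋖t))
      (λ p⋖q → (_ , p⋖q , ≤P.refl) , (_ , ≤P.refl , p⋖q))

-- The extended restriction function and Γ(P, R̂)

module GammaFacts (S : Setting) (h h̃ : Fin (Setting.n S) → ℕ)
  (isHeight : ∀ p → IsHeight S p (h p)) (isCoheight : ∀ p → IsCoheight S p (h̃ p)) where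
  open Setting S
  open PosetFacts S public
  open Heights h h̃ isHeight isCoheight public
  open Hat S h h̃
  open GammaDefs leqᵇ R using () renaming (minAll to minR; maxAll to maxR)

  -- The two padding values of `R̂ p`. Subtracting the coheight and adding the height makes both
  -- strictly increasing along P, so strictness survives where two fibres are padded at the same
  -- end.
  lo hi : Fin n → ℤ
  lo p = minR ℤ.- + h̃ p
  hi p = maxR ℤ.+ + h p

  lo-mono : ∀ {p q} → p <P q → lo p <ℤ lo q
  lo-mono p<q = ℤP.+-monoʳ-< minR (ℤP.neg-mono-< (ℤ.+<+ (h̃-anti p<q)))

  hi-mono : ∀ {p q} → p <P q → hi p <ℤ hi q
  hi-mono p<q = ℤP.+-monoʳ-< maxR (ℤ.+<+ (h-mono p<q))

  lo<minR : ∀ p → lo p <ℤ minR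
  lo<minR p = subst (lo p <ℤ_) (ℤP.+-identityʳ minR) (ℤP.+-monoʳ-< minR (ℤP.neg-mono-< (ℤ.+<+ (1≤h̃ p))))

  maxR<hi : ∀ p → maxR <ℤ hi p
  maxR<hi p = subst (_<ℤ hi p) (ℤP.+-identityʳ maxR) (ℤP.+-monoʳ-< maxR (ℤ.+<+ (1≤h p)))

  lo<R : ∀ {p x} q → x ∈ toList (R p) → lo q <ℤ x
  lo<R q x∈ = ℤP.<-≤-trans (lo<minR q) (minAll-≤ R x∈)

  R<hi : ∀ {p x} q → x ∈ toList (R p) → x <ℤ hi q
  R<hi q x∈ = ℤP.≤-<-trans (≤-maxAll R x∈) (maxR<hi q)

  lo<hi : ∀ p q → lo p <ℤ hi q
  lo<hi p q = ℤP.<-trans (lo<R p (here {xs = List⁺.tail (R p)} refl)) (R<hi {p} q (here refl))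

  R⊆R̂ : ∀ {p x} → x ∈ toList (R p) → x ∈ toList (R̂ p)
  R⊆R̂ = there ∘ there

  lo∈R̂ : ∀ {p} → lo p ∈ toList (R̂ p)
  lo∈R̂ = here refl

  hi∈R̂ : ∀ {p} → hi p ∈ toList (R̂ p)
  hi∈R̂ = there (here refl)

  lo-≤ : ∀ {p x} → x ∈ toList (R̂ p) → lo p ≤ℤ x
  lo-≤ (here refl)         = ℤP.≤-refl
  lo-≤ {p} (there (here refl)) = ℤP.<⇒≤ (lo<hi p p)
  lo-≤ {p} (there (there x∈))  = ℤP.<⇒≤ (lo<R p x∈)

  ≤-hi : ∀ {p x} → x ∈ toList (R̂ p) → x ≤ℤ hi p
  ≤-hi {p} (here refl)         = ℤP.<⇒≤ (lo<hi p p)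
  ≤-hi (there (here refl)) = ℤP.≤-refl
  ≤-hi {p} (there (there x∈))  = ℤP.<⇒≤ (R<hi p x∈)

  R̂-interior : ∀ {p x} → x ∈ toList (R̂ p) → lo p <ℤ x → x <ℤ hi p → x ∈ toList (R p)
  R̂-interior (here refl)         lo<x _    = contradiction lo<x (ℤP.<-irrefl refl)
  R̂-interior (there (here refl)) _    x<hi = contradiction x<hi (ℤP.<-irrefl refl)
  R̂-interior (there (there x∈))  _    _    = x∈

  -- Apart from its own upper padding, everything in `R̂ p` is at most `maxR`, hence below the upper
  -- padding of every fibre.
  R̂-<hi : ∀ {p x} q → x ∈ toList (R̂ p) → x <ℤ hi p → x <ℤ hi q
  R̂-<hi {p} q (here refl)         _    = lo<hi p q
  R̂-<hi q (there (here refl)) x<hi = contradiction x<hi (ℤP.<-irrefl refl)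
  R̂-<hi q (there (there x∈))  _    = R<hi q x∈

  minL-R̂ : ∀ p → minL (R̂ p) ≡ lo p
  minL-R̂ p with Minℤ.foldr₁-extremum (R̂ p)
  ... | m∈ , m≤ = ℤP.≤-antisym (m≤ lo∈R̂) (lo-≤ m∈)

  maxL-R̂ : ∀ p → maxL (R̂ p) ≡ hi p
  maxL-R̂ p with Maxℤ.foldr₁-extremum (R̂ p)
  ... | m∈ , ≤m = ℤP.≤-antisym (≤-hi m∈) (≤m hi∈R̂)

  InΓ : Fin n × ℤ → Set
  InΓ (p , k) = k ∈ toList (R̂ p) × k <ℤ hi p

  ≢maxL⇒<hi : ∀ p {k} → k ∈ toList (R̂ p) → k ≢ maxL (R̂ p) → k <ℤ hi p
  ≢maxL⇒<hi p k∈ k≢ = ℤP.≤∧≢⇒< (≤-hi k∈) (λ e → k≢ (trans e (sym (maxL-R̂ p))))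

  <hi⇒≢maxL : ∀ p {k} → k <ℤ hi p → k ≢ maxL (R̂ p)
  <hi⇒≢maxL p k<hi k≡ = ℤP.<-irrefl (trans k≡ (maxL-R̂ p)) k<hi

  inΓ-reflects : ∀ x → Reflects (InΓ x) (inΓ x)
  inΓ-reflects (p , k) = reflects-map
    (∈ᵇ-reflects k (toList (R̂ p)) ×-reflects ¬-reflects (isYes-reflects (k ℤP.≟ maxL (R̂ p))))
    (λ (k∈ , k≢) → k∈ , ≢maxL⇒<hi p k∈ k≢)
    (λ (k∈ , k<hi) → k∈ , <hi⇒≢maxL p k<hi)

  R⊆Γ : ∀ {p k} → k ∈ toList (R p) → InΓ (p , k)
  R⊆Γ k∈ = R⊆R̂ k∈ , R<hi _ k∈

  _⋖Γ_ : Fin n × ℤ → Fin n × ℤ → Set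
  (p₁ , k₁) ⋖Γ (p₂ , k₂) = InΓ (p₁ , k₁) × InΓ (p₂ , k₂) ×
    ( (p₁ ≡ p₂ × IsSucc (toList (R̂ p₁)) k₂ k₁)
    ⊎ (p₁ ⋖ p₂ × IsPred (toList (R̂ p₁)) k₂ k₁ × k₁ ≢ maxL (R̂ p₁)
       × ¬ Any (λ k → k₂ <ℤ k × IsPred (toList (R̂ p₁)) k k₁) (toList (R̂ p₂))))

  coverΓ-reflects : ∀ x y → Reflects (x ⋖Γ y) (coverΓ x y)
  coverΓ-reflects (p₁ , k₁) (p₂ , k₂) =
    inΓ-reflects (p₁ , k₁) ×-reflects inΓ-reflects (p₂ , k₂) ×-reflects
    ( (isYes-reflects (p₁ FinP.≟ p₂) ×-reflects succIn-reflects (R̂ p₁) k₂ k₁)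
    ⊎-reflects
      (coverP-reflects R̂ p₁ p₂ ×-reflects predIn-reflects (R̂ p₁) k₂ k₁ ×-reflects
       ¬-reflects (isYes-reflects (k₁ ℤP.≟ maxL (R̂ p₁))) ×-reflects
       ¬-reflects (any-reflects (λ k → isYes-reflects (k₂ ℤP.<? k) ×-reflects predIn-reflects (R̂ p₁) k k₁)
                                (toList (R̂ p₂)))))

  ∈-Γlist⁺ : ∀ {x} → InΓ x → x ∈ Γlist
  ∈-Γlist⁺ {p , k} (k∈ , k<hi) = ∈-concatMap⁺ _
    (lose (∈-allFin p) (∈-map⁺ (p ,_) (∈-filterᵇ⁺ (λ k → inΓ-reflects (p , k)) k∈ (k∈ , k<hi))))

  ∈-Γlist⁻ : ∀ {x} → x ∈ Γlist → InΓ x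
  ∈-Γlist⁻ {x} x∈ with find (∈-concatMap⁻ _ {xs = allFin n} x∈)
  ... | p , _ , x∈p with ∈-map⁻ (p ,_) x∈p
  ...   | k , k∈ , refl = proj₂ (∈-filterᵇ⁻ (λ k → inΓ-reflects (p , k)) (toList (R̂ p)) k∈)

  -- Starring removes only the upper padding. So the boundary condition sits on the lower padding
  -- value and, by `maxStar-maxL`, on the maximum of `R p` itself.
  minStar-lo : ∀ p → minStar p ≡ lo p
  minStar-lo p = fromMaybe-==ᵐ (minMaybe candidates) (⇒T (minMaybe-reflects candidates (lo p))
    ( ∈-filterᵇ⁺ ≢max-reflects lo∈R̂ (<hi⇒≢maxL p (lo<hi p p))
    , λ y∈ → lo-≤ (proj₁ (∈-filterᵇ⁻ ≢max-reflects (toList (R̂ p)) y∈))))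
    where
    candidates : List ℤ
    candidates = filterᵇ (λ k → not ⌊ k ℤP.≟ maxL (R̂ p) ⌋) (toList (R̂ p))
    ≢max-reflects : ∀ k → Reflects (k ≢ maxL (R̂ p)) (not ⌊ k ℤP.≟ maxL (R̂ p) ⌋)
    ≢max-reflects k = ¬-reflects (isYes-reflects (k ℤP.≟ maxL (R̂ p)))

  maxStar-maxL : ∀ p → maxStar p ≡ maxL (R p)
  maxStar-maxL p with Maxℤ.foldr₁-extremum (R p)
  ... | m∈ , ≤m = fromMaybe-==ᵐ (predIn (R̂ p) (maxL (R̂ p))) (⇒T (predIn-reflects (R̂ p) (maxL (R̂ p)) (maxL (R p)))
    ( R⊆R̂ m∈ , subst (maxL (R p) <ℤ_) (sym (maxL-R̂ p)) (R<hi p m∈) , bound))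
    where
    bound : ∀ {x} → x ∈ toList (R̂ p) → x <ℤ maxL (R̂ p) → x ≤ℤ maxL (R p)
    bound (here refl)         _   = ℤP.<⇒≤ (lo<R p m∈)
    bound (there (here refl)) x<  = contradiction (sym (maxL-R̂ p)) (ℤP.<⇒≢ x<)
    bound (there (there x∈))  _   = ≤m x∈

  succ-R̂ : ∀ {p k s} → k ∈ toList (R p) → IsSucc (toList (R p)) k s → IsSucc (toList (R̂ p)) k s
  succ-R̂ {p} {k} {s} k∈ (s∈ , k<s , s≤) = R⊆R̂ s∈ , k<s , bound
    where
    bound : ∀ {x} → x ∈ toList (R̂ p) → k <ℤ x → s ≤ℤ x
    bound (here refl)         k<lo = contradiction (lo<R p k∈) (ℤP.<-asym k<lo)
    bound (there (here refl)) _    = ℤP.<⇒≤ (R<hi p s∈)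
    bound (there (there x∈))  k<x  = s≤ x∈ k<x

-- Labelings and Φ

module LabelingFacts (S : Setting) (h h̃ : Fin (Setting.n S) → ℕ)
  (isHeight : ∀ p → IsHeight S p (h p)) (isCoheight : ∀ p → IsCoheight S p (h̃ p))
  (u+v≤ℓ : ∀ p → Setting.u S p + Setting.v S p ≤ Setting.ℓ S)
  (uv-mono : ∀ p₁ p₂ → Setting._≤P_ S p₁ p₂ →
     Setting.v S p₁ ≤ Setting.v S p₂ × Setting.u S p₂ ≤ Setting.u S p₁) where
  open Setting S
  open GammaFacts S h h̃ isHeight isCoheight public
  open Hat S h h̃

  v≤ℓ : ∀ p → v p ≤ ℓ
  v≤ℓ p = ℕP.m+n≤o⇒n≤o (u p) (u+v≤ℓ p)

  u≤ℓ : ∀ p → u p ≤ ℓ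
  u≤ℓ p = ℕP.m+n≤o⇒m≤o (u p) (u+v≤ℓ p)

  1+ℓ∸v : ∀ p → suc ℓ ∸ v p ≡ suc (ℓ ∸ v p)
  1+ℓ∸v p = ℕP.+-∸-assoc 1 (v≤ℓ p)

  u<1+ℓ∸v : ∀ p → u p < suc ℓ ∸ v p
  u<1+ℓ∸v p = subst (u p <_) (sym (1+ℓ∸v p)) (s≤s (ℕP.m+n≤o⇒m≤o∸n (u p) (u+v≤ℓ p)))

  InDomᵇ-reflects : ∀ p i → Reflects (InDom S p i) (InDomᵇ S p i)
  InDomᵇ-reflects p i = ℕP.<ᵇ-reflects-< (u p) i ×-reflects ℕP.<ᵇ-reflects-< i (suc ℓ ∸ v p)

  data Position p i : Set where
    low  : i ≤ u p → Position p i
    dom  : InDom S p i → Position p i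
    high : suc ℓ ∸ v p ≤ i → Position p i

  position : ∀ p i → Position p i
  position p i with i ≤? u p
  ... | yes i≤u = low i≤u
  ... | no i≰u with i <? suc ℓ ∸ v p
  ...   | yes i< = dom (ℕP.≰⇒> i≰u , i<)
  ...   | no i≮  = high (ℕP.≮⇒≥ i≮)

  module _ (f : Lab S) {p : Fin n} {i : ℕ} where

    fhat-low : i ≤ u p → fhat f p i ≡ lo p
    fhat-low i≤u = trans (if-yes (ℕP.≤ᵇ-reflects-≤ i (u p)) i≤u) (minL-R̂ p)

    fhat-dom : InDom S p i → fhat f p i ≡ f p i
    fhat-dom (u<i , i<) = trans (if-no (ℕP.≤ᵇ-reflects-≤ i (u p)) (ℕP.<⇒≱ u<i))
                                (if-yes (ℕP.<ᵇ-reflects-< i (suc ℓ ∸ v p)) i<)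

    fhat-high : suc ℓ ∸ v p ≤ i → fhat f p i ≡ hi p
    fhat-high ≤i = trans (if-no (ℕP.≤ᵇ-reflects-≤ i (u p)) (ℕP.<⇒≱ (ℕP.<-≤-trans (u<1+ℓ∸v p) ≤i)))
                  (trans (if-no (ℕP.<ᵇ-reflects-< i (suc ℓ ∸ v p)) (ℕP.≤⇒≯ ≤i)) (maxL-R̂ p))

    fhat∈R⇒dom : fhat f p i ∈ toList (R p) → InDom S p i
    fhat∈R⇒dom f̂∈ with position p i
    ... | low i≤u = contradiction (lo<R p f̂∈) (ℤP.<-irrefl (sym (fhat-low i≤u)))
    ... | dom d   = d
    ... | high ≤i = contradiction (R<hi p f̂∈) (ℤP.<-irrefl (fhat-high ≤i))

  fhat-cong : ∀ f g {p i} → f p i ≡ g p i → fhat f p i ≡ fhat g p i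
  fhat-cong f g {p} {i} =
    cong (λ x → if i ≤ᵇ u p then minL (R̂ p) else if i <ᵇ suc ℓ ∸ v p then x else maxL (R̂ p))

  -- As `u` decreases and `v` increases along P, going up can leave the domain only at its upper
  -- end, and going down only at its lower end.
  dom-below⇒ : ∀ {p q i} → p ≤P q → InDom S p i → InDom S q i ⊎ suc ℓ ∸ v q ≤ i
  dom-below⇒ {p} {q} {i} p≤q (u<i , _) with position q i
  ... | low i≤u = contradiction (ℕP.≤-trans i≤u (proj₂ (uv-mono p q p≤q))) (ℕP.<⇒≱ u<i)
  ... | dom d   = inj₁ d
  ... | high ≤i = inj₂ ≤i

  dom-above⇒ : ∀ {p q i} → p ≤P q → InDom S q i → i ≤ u p ⊎ InDom S p i
  dom-above⇒ {p} {q} {i} p≤q (_ , i<) with position p i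
  ... | low i≤u = inj₁ i≤u
  ... | dom d   = inj₂ d
  ... | high ≤i = contradiction (ℕP.≤-trans (ℕP.∸-monoʳ-≤ (suc ℓ) (proj₁ (uv-mono p q p≤q))) ≤i) (ℕP.<⇒≱ i<)

  module Labeling {f : Lab S} (lf : IsLabeling S f) where
    open IsLabeling lf

    fhat-∈ : ∀ p i → fhat f p i ∈ toList (R̂ p)
    fhat-∈ p i with position p i
    ... | low i≤u = subst (_∈ toList (R̂ p)) (sym (fhat-low f i≤u)) lo∈R̂
    ... | dom d   = subst (_∈ toList (R̂ p)) (sym (fhat-dom f d)) (R⊆R̂ (restr d))
    ... | high ≤i = subst (_∈ toList (R̂ p)) (sym (fhat-high f ≤i)) hi∈R̂

    fhat-mono : ∀ {p i j} → i ≤ j → fhat f p i ≤ℤ fhat f p j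
    fhat-mono {p} {i} {j} i≤j with position p i | position p j
    ... | low i≤u | _       = subst (_≤ℤ fhat f p j) (sym (fhat-low f i≤u)) (lo-≤ (fhat-∈ p j))
    ... | dom di  | low j≤u = contradiction (ℕP.≤-trans i≤j j≤u) (ℕP.<⇒≱ (proj₁ di))
    ... | dom di  | dom dj  = subst₂ _≤ℤ_ (sym (fhat-dom f di)) (sym (fhat-dom f dj)) (weakI di dj i≤j)
    ... | _       | high ≤j = subst (fhat f p i ≤ℤ_) (sym (fhat-high f ≤j)) (≤-hi (fhat-∈ p i))
    ... | high ≤i | low j≤u = contradiction (ℕP.≤-trans (ℕP.<-≤-trans (u<1+ℓ∸v p) ≤i) i≤j) (ℕP.≤⇒≯ j≤u)
    ... | high ≤i | dom dj  = contradiction (ℕP.≤-trans ≤i i≤j) (ℕP.<⇒≱ (proj₂ dj))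

    fhat-strict : ∀ {p q i} → p <P q → fhat f p i <ℤ fhat f q i
    fhat-strict {p} {q} {i} p<q with position p i | position q i
    ... | low a  | low b  = subst₂ _<ℤ_ (sym (fhat-low f a)) (sym (fhat-low f b)) (lo-mono p<q)
    ... | low a  | dom b  = subst₂ _<ℤ_ (sym (fhat-low f a)) (sym (fhat-dom f b)) (lo<R p (restr b))
    ... | low a  | high b = subst₂ _<ℤ_ (sym (fhat-low f a)) (sym (fhat-high f b)) (lo<hi p q)
    ... | dom a  | dom b  = subst₂ _<ℤ_ (sym (fhat-dom f a)) (sym (fhat-dom f b)) (strictP a b p<q)
    ... | dom a  | high b = subst₂ _<ℤ_ (sym (fhat-dom f a)) (sym (fhat-high f b)) (R<hi q (restr a))
    ... | high a | high b = subst₂ _<ℤ_ (sym (fhat-high f a)) (sym (fhat-high f b)) (hi-mono p<q)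
    -- In the remaining cases q would sit in a lower zone than p, which the monotonicity of `u` and
    -- `v` excludes.
    ... | dom a  | low b  = contradiction (ℕP.≤-trans b (proj₂ (uv-mono p q (proj₁ p<q)))) (ℕP.<⇒≱ (proj₁ a))
    ... | high a | low b  = contradiction (ℕP.≤-trans b (proj₂ (uv-mono p q (proj₁ p<q))))
                                          (ℕP.<⇒≱ (ℕP.<-≤-trans (u<1+ℓ∸v p) a))
    ... | high a | dom b  = contradiction (ℕP.≤-trans (ℕP.∸-monoʳ-≤ (suc ℓ) (proj₁ (uv-mono p q (proj₁ p<q)))) a)
                                          (ℕP.<⇒≱ (proj₂ b))

    fhat-mono-≤P : ∀ {p q i} → p ≤P q → fhat f p i ≤ℤ fhat f q i
    fhat-mono-≤P {i = i} p≤q with ≤P⇒<P⊎≡ p≤q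
    ... | inj₁ p<q  = ℤP.<⇒≤ (fhat-strict {i = i} p<q)
    ... | inj₂ refl = ℤP.≤-refl

  exceeds? : ∀ f p k → Decidable (λ i → k <ℤ fhat f p i)
  exceeds? f p k i = k ℤP.<? fhat f p i

  Φ-# : ∀ f p k → Φ f (p , k) ≡ # (exceeds? f p k) ℓ
  Φ-# f p k = countᵇ-range1 (exceeds? f p k) (λ i → isYes-reflects (k ℤP.<? fhat f p i)) ℓ

  Φ-threshold : ∀ f p k {t} → (∀ {i} → 1 ≤ i → i ≤ ℓ → (k <ℤ fhat f p i → t < i) × (t < i → k <ℤ fhat f p i)) →
    Φ f (p , k) ≡ ℓ ∸ t
  Φ-threshold f p k {t} k<⇔ = trans (Φ-# f p k) (trans (#-cong (exceeds? f p k) (t <?_) ℓ k<⇔) (#-threshold t ℓ))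

  module _ {f : Lab S} (lf : IsLabeling S f) where
    open Labeling lf
    open IsLabeling lf

    -- Between fibres: k₁ is the predecessor of k₂ in `R̂ p₁`, so a label of p₁ above k₁ is at least
    -- k₂, and strictness pushes the label of p₂ beyond k₂.
    Φ-cover-mono : ∀ {x y} → x ⋖Γ y → Φ f x ≤ Φ f y
    Φ-cover-mono {p₁ , k₁} {p₂ , k₂} (_ , _ , c) = subst₂ _≤_ (sym (Φ-# f p₁ k₁)) (sym (Φ-# f p₂ k₂))
      (#-mono (exceeds? f p₁ k₁) (exceeds? f p₂ k₂) ℓ λ {i} _ _ → step c {i})
      where
      step : _ → ∀ {i} → k₁ <ℤ fhat f p₁ i → k₂ <ℤ fhat f p₂ i
      step (inj₁ (refl , (_ , k₂<k₁ , _))) k₁< = ℤP.<-trans k₂<k₁ k₁<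
      step (inj₂ (p₁⋖p₂ , (_ , _ , ≤k₁) , _)) {i} k₁< = ℤP.≤-<-trans
        (ℤP.≮⇒≥ λ f̂<k₂ → ℤP.<⇒≱ k₁< (≤k₁ (fhat-∈ p₁ i) f̂<k₂))
        (fhat-strict {i = i} (proj₁ p₁⋖p₂))

    Φ-mono : ∀ {x y} → x ≤Γ y → Φ f x ≤ Φ f y
    Φ-mono ε       = ℕP.≤-refl
    Φ-mono {x} (_◅_ {j = y} c cs) = ℕP.≤-trans (Φ-cover-mono {x} {y} (T⇒ (coverΓ-reflects x y) c)) (Φ-mono cs)

    Φ-lo : ∀ p → Φ f (p , lo p) ≡ ℓ ∸ u p
    Φ-lo p = Φ-threshold f p (lo p) λ _ _ →
      (λ lo<f̂ → ℕP.≰⇒> λ i≤u → ℤP.<-irrefl (sym (fhat-low f i≤u)) lo<f̂) ,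
      above
      where
      above : ∀ {i} → u p < i → lo p <ℤ fhat f p i
      above {i} u<i with position p i
      ... | low i≤u = contradiction i≤u (ℕP.<⇒≱ u<i)
      ... | dom d   = subst (lo p <ℤ_) (sym (fhat-dom f d)) (lo<R p (restr d))
      ... | high ≤i = subst (lo p <ℤ_) (sym (fhat-high f ≤i)) (lo<hi p p)

    Φ-max : ∀ p → Φ f (p , maxL (R p)) ≡ v p
    Φ-max p = trans (Φ-threshold f p (maxL (R p)) λ {i} _ _ →
        above , λ ℓ∸v<i → subst (maxL (R p) <ℤ_) (sym (fhat-high f {p} {i} (subst (_≤ i) (sym (1+ℓ∸v p)) ℓ∸v<i))) (R<hi p m∈))
      (ℕP.m∸[m∸n]≡n (v≤ℓ p))
      where
      m∈ = proj₁ (Maxℤ.foldr₁-extremum (R p))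
      above : ∀ {i} → maxL (R p) <ℤ fhat f p i → ℓ ∸ v p < i
      above {i} m<f̂ with position p i
      ... | low i≤u = contradiction (subst (maxL (R p) <ℤ_) (fhat-low f i≤u) m<f̂) (ℤP.<-asym (lo<R p m∈))
      ... | dom d   = contradiction (proj₂ (Maxℤ.foldr₁-extremum (R p)) (restr d))
                                    (ℤP.<⇒≱ (subst (maxL (R p) <ℤ_) (fhat-dom f d) m<f̂))
      ... | high ≤i = subst (_≤ i) (1+ℓ∸v p) ≤i

    Φ-InA : InA (Φ f)
    Φ-InA = record
      { bounded = λ (p , k) _ → subst₂ _≤_ (sym (Φ-# f p k)) (#-threshold 0 ℓ)
                    (#-mono (exceeds? f p k) (0 <?_) ℓ λ 1≤i _ _ → 1≤i)
      ; mono = λ x y _ _ → Φ-mono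
      ; bMin = λ p → trans (cong (λ k → Φ f (p , k)) (minStar-lo p)) (Φ-lo p)
      ; bMax = λ p → trans (cong (λ k → Φ f (p , k)) (maxStar-maxL p)) (Φ-max p)
      }

  1≤dom : ∀ {p i} → InDom S p i → 1 ≤ i
  1≤dom (u<i , _) = ℕP.≤-trans (s≤s z≤n) u<i

  dom≤ℓ : ∀ {p i} → InDom S p i → i ≤ ℓ
  dom≤ℓ {p} (_ , i<) = ℕP.≤-pred (ℕP.≤-trans i< (ℕP.m∸n≤m (suc ℓ) (v p)))

  -- Two labels in R p are separated by the threshold at the smaller one.
  Φ-injective-≤ : ∀ {f g} → IsLabeling S f → IsLabeling S g → (∀ x → T (inΓ x) → Φ f x ≡ Φ g x) →
    ∀ {p i} → InDom S p i → g p i ≤ℤ f p i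
  Φ-injective-≤ {f} {g} lf lg Φf≡Φg {p} {i} d = ℤP.≮⇒≥ λ f<g → ℤP.<-irrefl refl
    (subst (f p i <ℤ_) (fhat-dom f d)
      (#-upset-⊆ (exceeds? g p (f p i)) (exceeds? f p (f p i))
        (λ i≤j k< → ℤP.<-≤-trans k< (Labeling.fhat-mono lg i≤j))
        (λ i≤j k< → ℤP.<-≤-trans k< (Labeling.fhat-mono lf i≤j))
        (trans (sym (Φ-# g p (f p i))) (trans (sym (Φf≡Φg _ (⇒T (inΓ-reflects _) (R⊆Γ (IsLabeling.restr lf d))))) (Φ-# f p (f p i))))
        (1≤dom d) (dom≤ℓ d)
        (subst (f p i <ℤ_) (sym (fhat-dom g d)) f<g)))

  -- The inverse of Φ

  module Surjectivity {σ : QPart} (σ∈A : InA σ) where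
    open InA σ∈A

    σ-bounded : ∀ {x} → InΓ x → σ x ≤ ℓ
    σ-bounded x∈ = bounded _ (⇒T (inΓ-reflects _) x∈)

    σ-cover : ∀ {x y} → x ⋖Γ y → σ x ≤ σ y
    σ-cover {x} {y} c = mono x y (⇒T (inΓ-reflects x) (proj₁ c)) (⇒T (inΓ-reflects y) (proj₁ (proj₂ c)))
      (⇒T (coverΓ-reflects x y) c ◅ ε)

    -- Each move to the successor is a cover of Γ. The distance from k to k′ is the fuel, and every
    -- move shortens it by at least one.
    σ-fibre : ∀ {p k k′} → InΓ (p , k) → InΓ (p , k′) → k ≤ℤ k′ → σ (p , k′) ≤ σ (p , k)
    σ-fibre {p} {k} {k′} k∈ k′∈ k≤k′ = go ℤ.∣ k′ ℤ.- k ∣ k∈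
        (ℤP.≤-reflexive (sym (i+∣j-i∣≡j k≤k′))) k≤k′
      where
      go : ∀ m {k} → InΓ (p , k) → k′ ≤ℤ k ℤ.+ + m → k ≤ℤ k′ → σ (p , k′) ≤ σ (p , k)
      go m {k} k∈ k′≤ k≤k′ with k ℤP.≟ k′
      ... | yes refl = ℕP.≤-refl
      go zero    {k} k∈ k′≤ k≤k′ | no k≢k′ = contradiction (ℤP.≤-antisym k≤k′ (subst (k′ ≤ℤ_) (ℤP.+-identityʳ k) k′≤)) k≢k′
      go (suc m) {k} k∈ k′≤ k≤k′ | no k≢k′ with succ-exists (proj₁ k′∈) (ℤP.≤∧≢⇒< k≤k′ k≢k′)
      ... | s , isSucc@(s∈ , k<s , s≤) = ℕP.≤-trans
          (go m s∈Γ (ℤP.≤-trans k′≤ k+1+m≤s+m) s≤k′)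
          (σ-cover (s∈Γ , k∈ , inj₁ (refl , isSucc)))
        where
        s≤k′ = s≤ (proj₁ k′∈) (ℤP.≤∧≢⇒< k≤k′ k≢k′)
        s∈Γ : InΓ (p , s)
        s∈Γ = s∈ , ℤP.≤-<-trans s≤k′ (proj₂ k′∈)
        k+1+m≤s+m : k ℤ.+ + suc m ≤ℤ s ℤ.+ + m
        k+1+m≤s+m = subst (_≤ℤ s ℤ.+ + m)
          (trans (cong (ℤ._+ + m) (ℤP.+-comm (+ 1) k)) (ℤP.+-assoc k (+ 1) (+ m)))
          (ℤP.+-monoˡ-≤ (+ m) (ℤP.i<j⇒suc[i]≤j k<s))

    -- The guard leaves out `hi p`, which is not in Γ, so that σ is unconstrained there.
    Reached : Fin n → ℕ → ℤ → Set
    Reached p i k = k <ℤ hi p × i ≤ ℓ ∸ σ (p , k)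

    reached? : ∀ p i → Decidable (Reached p i)
    reached? p i k = (k ℤP.<? hi p) ×-dec (i ≤? ℓ ∸ σ (p , k))

    least : ∀ p i → ∃ λ m → m ∈ toList (R̂ p) × (Reached p i m ⊎ m ≡ hi p) ×
      (∀ {k} → k ∈ toList (R̂ p) → Reached p i k → m ≤ℤ k)
    least p i with Any.any? (reached? p i) (toList (R̂ p))
    ... | no none  = hi p , hi∈R̂ , inj₂ refl , λ k∈ r → contradiction (lose k∈ r) none
    ... | yes some with find some
    ...   | k , k∈ , r with Minℤ.extremum-of (reached? p i) k∈ r
    ...     | m , m∈ , rm , m≤ = m , m∈ , inj₁ rm , m≤

    F : Lab S
    F p i = proj₁ (least p i)

    F∈ : ∀ p i → F p i ∈ toList (R̂ p)
    F∈ p i = proj₁ (proj₂ (least p i))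

    -- Together with `⇒F≤` a Galois connection between labels and indices, through which `F` is
    -- handled from here on. This direction rests on σ decreasing along the fibre, the other on
    -- minimality.
    F≤⇒ : ∀ {p i k} → InΓ (p , k) → F p i ≤ℤ k → i ≤ ℓ ∸ σ (p , k)
    F≤⇒ {p} {i} {k} k∈ F≤k with least p i
    ... | m , m∈ , inj₁ (m<hi , i≤) , _ = ℕP.≤-trans i≤ (ℕP.∸-monoʳ-≤ ℓ (σ-fibre (m∈ , m<hi) k∈ F≤k))
    ... | m , m∈ , inj₂ refl , _        = contradiction F≤k (ℤP.<⇒≱ (proj₂ k∈))

    ⇒F≤ : ∀ {p i k} → InΓ (p , k) → i ≤ ℓ ∸ σ (p , k) → F p i ≤ℤ k
    ⇒F≤ {p} {i} (k∈ , k<hi) i≤ = proj₂ (proj₂ (proj₂ (least p i))) k∈ (k<hi , i≤)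

    F-mono : ∀ {p i j} → i ≤ j → F p i ≤ℤ F p j
    F-mono {p} {i} {j} i≤j with least p j
    ... | m , m∈ , inj₁ (m<hi , j≤) , _ = ⇒F≤ (m∈ , m<hi) (ℕP.≤-trans i≤j j≤)
    ... | m , m∈ , inj₂ refl , _        = ≤-hi (F∈ p i)

    -- Let k₁ be the predecessor of `F q i` in `R̂ p` and k₂ the largest element of `R̂ q` with that
    -- same predecessor. Then (q , k₂) covers (p , k₁), so σ(p,k₁) ≤ σ(q,k₂) ≤ σ(q,F q i). Hence i
    -- is already reached at k₁, and `F p i` ≤ k₁ < `F q i`.
    F-cover : ∀ {i p q} → p ⋖ q → F p i <ℤ F q i
    F-cover {i} {p} {q} p⋖q with F q i ℤP.<? hi q
    ... | no F≮hi = ℤP.≤-<-trans (≤-hi (F∈ p i)) (ℤP.<-≤-trans (hi-mono (proj₁ p⋖q)) (ℤP.≮⇒≥ F≮hi))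
    ... | yes F<hi with pred-exists (lo∈R̂ {p}) (ℤP.<-≤-trans (lo-mono (proj₁ p⋖q)) (lo-≤ (F∈ q i)))
    ...   | k₁ , isPred@(k₁∈ , k₁<F , ≤k₁)
      with Maxℤ.extremum-of (λ k → T? (predIn (R̂ p) k ==ᵐ k₁)) (F∈ q i) (⇒T (predIn-reflects (R̂ p) _ k₁) isPred)
    ...     | k₂ , k₂∈ , isPred₂ , ≤k₂ = ℤP.≤-<-trans (⇒F≤ k₁∈Γ i≤) k₁<F
      where
      pred₂ : IsPred (toList (R̂ p)) k₂ k₁
      pred₂ = T⇒ (predIn-reflects (R̂ p) k₂ k₁) isPred₂
      F<hip : F q i <ℤ hi p
      F<hip = R̂-<hi p (F∈ q i) F<hi
      k₁∈Γ : InΓ (p , k₁)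
      k₁∈Γ = k₁∈ , ℤP.<-trans k₁<F F<hip
      -- Were k₂ the padding value of q, it would exceed `hi p`, and its predecessor k₁ in `R̂ p`
      -- would be at least `hi p`.
      k₂<hi : k₂ <ℤ hi q
      k₂<hi = ℤP.≰⇒> λ hi≤k₂ → ℤP.<⇒≱ (proj₂ k₁∈Γ)
        (proj₂ (proj₂ pred₂) hi∈R̂ (ℤP.<-≤-trans (hi-mono (proj₁ p⋖q)) hi≤k₂))
      cover : (p , k₁) ⋖Γ (q , k₂)
      cover = k₁∈Γ , (k₂∈ , k₂<hi) , inj₂ (p⋖q , pred₂ , <hi⇒≢maxL p (proj₂ k₁∈Γ) , λ some →
        let (k , k∈ , k₂<k , pr) = find some
        in ℤP.<⇒≱ k₂<k (≤k₂ k∈ (⇒T (predIn-reflects (R̂ p) k k₁) pr)))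
      i≤ : i ≤ ℓ ∸ σ (p , k₁)
      i≤ = ℕP.≤-trans (F≤⇒ (F∈ q i , F<hi) ℤP.≤-refl) (ℕP.∸-monoʳ-≤ ℓ
        (ℕP.≤-trans (σ-cover cover)
          (σ-fibre (F∈ q i , F<hi) (k₂∈ , k₂<hi) (≤k₂ (F∈ q i) (⇒T (predIn-reflects (R̂ p) _ k₁) isPred)))))

    lo∈Γ : ∀ {p} → InΓ (p , lo p)
    lo∈Γ {p} = lo∈R̂ , lo<hi p p

    max∈Γ : ∀ {p} → InΓ (p , maxL (R p))
    max∈Γ {p} = R⊆Γ (proj₁ (Maxℤ.foldr₁-extremum (R p)))

    ℓ∸σlo : ∀ p → ℓ ∸ σ (p , lo p) ≡ u p
    ℓ∸σlo p = trans (cong (λ k → ℓ ∸ σ (p , k)) (sym (minStar-lo p)))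
      (trans (cong (ℓ ∸_) (bMin p)) (ℕP.m∸[m∸n]≡n (u≤ℓ p)))

    ℓ∸σmax : ∀ p → ℓ ∸ σ (p , maxL (R p)) ≡ ℓ ∸ v p
    ℓ∸σmax p = trans (cong (λ k → ℓ ∸ σ (p , k)) (sym (maxStar-maxL p))) (cong (ℓ ∸_) (bMax p))

    -- The boundary values of σ put the thresholds of `lo p` and `maxL (R p)` at `u p` and
    -- `ℓ ∸ v p`, the two ends of the domain.
    F-restr : ∀ {p i} → InDom S p i → F p i ∈ toList (R p)
    F-restr {p} {i} (u<i , i<) = R̂-interior (F∈ p i)
      (ℤP.≰⇒> λ F≤lo → ℕP.<⇒≱ u<i (subst (i ≤_) (ℓ∸σlo p) (F≤⇒ lo∈Γ F≤lo)))
      (ℤP.≤-<-trans (⇒F≤ max∈Γ (subst (i ≤_) (sym (ℓ∸σmax p)) (ℕP.≤-pred (subst (i <_) (1+ℓ∸v p) i<)))) (proj₂ (max∈Γ {p})))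

    F-labeling : IsLabeling S F
    F-labeling = record
      { strictP = λ {p} {q} {i} _ _ → cover-induction (λ p q → F p i <ℤ F q i) ℤP.<-trans F-cover
      ; weakI   = λ _ _ → F-mono
      ; restr   = F-restr
      }

    -- `F` already takes the padding values outside the domain, so the Galois connection for `F` can
    -- be read as one for `fhat F`.
    F-hat : ∀ p i → fhat F p i ≡ F p i
    F-hat p i with position p i
    ... | low i≤u = trans (fhat-low F i≤u)
      (ℤP.≤-antisym (lo-≤ (F∈ p i)) (⇒F≤ lo∈Γ (subst (i ≤_) (sym (ℓ∸σlo p)) i≤u)))
    ... | dom d   = fhat-dom F d
    ... | high ≤i = trans (fhat-high F ≤i) (ℤP.≤-antisym (ℤP.≮⇒≥ λ F<hi → ℕP.<⇒≱ ≤i′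
        (subst (i ≤_) (ℓ∸σmax p) (F≤⇒ max∈Γ (F≤max F<hi)))) (≤-hi (F∈ p i)))
      where
      ≤i′ : ℓ ∸ v p < i
      ≤i′ = subst (_≤ i) (1+ℓ∸v p) ≤i
      F≤max : F p i <ℤ hi p → F p i ≤ℤ maxL (R p)
      F≤max F<hi with F∈ p i
      ... | here e           = subst (_≤ℤ maxL (R p)) (sym e) (ℤP.<⇒≤ (lo<R p (proj₁ (Maxℤ.foldr₁-extremum (R p)))))
      ... | there (here e)   = contradiction e (ℤP.<⇒≢ F<hi)
      ... | there (there F∈R) = proj₂ (Maxℤ.foldr₁-extremum (R p)) F∈R

    Φ-F : ∀ {x} → InΓ x → Φ F x ≡ σ x
    Φ-F {p , k} k∈ = trans (Φ-threshold F p k {ℓ ∸ σ (p , k)} λ {i} _ _ →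
        (λ k<F → ℕP.≰⇒> λ i≤ → ℤP.<⇒≱ (subst (k <ℤ_) (F-hat p i) k<F) (⇒F≤ k∈ i≤)) ,
        (λ <i → subst (k <ℤ_) (sym (F-hat p i)) (ℤP.≰⇒> λ F≤k → ℕP.<⇒≱ <i (F≤⇒ k∈ F≤k))))
      (ℕP.m∸[m∸n]≡n (σ-bounded k∈))

-- Raisable and lowerable labels

module BenderKnuth (S : Setting) (h h̃ : Fin (Setting.n S) → ℕ)
  (isHeight : ∀ p → IsHeight S p (h p)) (isCoheight : ∀ p → IsCoheight S p (h̃ p))
  (u+v≤ℓ : ∀ p → Setting.u S p + Setting.v S p ≤ Setting.ℓ S)
  (uv-mono : ∀ p₁ p₂ → Setting._≤P_ S p₁ p₂ →
     Setting.v S p₁ ≤ Setting.v S p₂ × Setting.u S p₂ ≤ Setting.u S p₁)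
  (raise? : ∀ f p i → Dec (Raisable S f p i)) (lower? : ∀ f p i → Dec (Lowerable S f p i)) where
  open Setting S
  open LabelingFacts S h h̃ isHeight isCoheight u+v≤ℓ uv-mono public
  open Hat S h h̃
  open Promotion S raise? lower?

  overwrite : Lab S → Fin n → (ℕ → ℤ) → Lab S
  overwrite f p val q i = if ⌊ q FinP.≟ p ⌋ then val i else f q i

  overwrite-at : ∀ f p val {i} → overwrite f p val p i ≡ val i
  overwrite-at f p val = if-yes (isYes-reflects (p FinP.≟ p)) refl

  overwrite-off : ∀ f p val {q i} → q ≢ p → overwrite f p val q i ≡ f q i
  overwrite-off f p val {q} = if-no (isYes-reflects (q FinP.≟ p))

  overwrite-labeling : ∀ {f p val} → IsLabeling S f →
    (∀ {i j} → InDom S p i → InDom S p j → i ≤ j → val i ≤ℤ val j) →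
    (∀ {i} → InDom S p i → val i ∈ toList (R p)) →
    (∀ {q i} → InDom S q i → InDom S p i → q <P p → f q i <ℤ val i) →
    (∀ {q i} → InDom S p i → InDom S q i → p <P q → val i <ℤ f q i) →
    IsLabeling S (overwrite f p val)
  overwrite-labeling {f} {p} {val} lf weak mem below above = record { strictP = strict ; weakI = mono ; restr = member }
    where
    open IsLabeling lf
    g : Lab S
    g = overwrite f p val
    strict : ∀ {q r i} → InDom S q i → InDom S r i → q <P r → g q i <ℤ g r i
    strict {q} {r} dq dr q<r with q FinP.≟ p | r FinP.≟ p
    ... | yes refl | yes refl = contradiction refl (proj₂ q<r)
    ... | yes refl | no _     = above dq dr q<r
    ... | no _     | yes refl = below dq dr q<r
    ... | no _     | no _     = strictP dq dr q<r
    mono : ∀ {q i j} → InDom S q i → InDom S q j → i ≤ j → g q i ≤ℤ g q j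
    mono {q} di dj i≤j with q FinP.≟ p
    ... | yes refl = weak di dj i≤j
    ... | no _     = weakI di dj i≤j
    member : ∀ {q i} → InDom S q i → g q i ∈ toList (R q)
    member {q} d with q FinP.≟ p
    ... | yes refl = mem d
    ... | no _     = restr d

  module _ {f : Lab S} (lf : IsLabeling S f) {p : Fin n} {k s : ℤ}
           (k∈ : k ∈ toList (R p)) (isSucc : IsSucc (toList (R p)) k s) where
    open Labeling lf
    open IsLabeling lf

    ≮succ⇒≤ : ∀ {x} → x ∈ toList (R p) → x <ℤ s → x ≤ℤ k
    ≮succ⇒≤ x∈ x<s = ℤP.≮⇒≥ λ k<x → ℤP.<⇒≱ x<s (proj₂ (proj₂ isSucc) x∈ k<x)

    -- With `⇒raisable` this replaces a quantification over labelings by a test at the single index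
    -- i. The witness has a label of at least s at (p , i), below the unchanged label of q; where q
    -- has left the domain, its padding exceeds s.
    raisable⇒ : ∀ {q i} → InDom S p i → f p i ≡ k → Raisable S f p i → p <P q → s <ℤ fhat f q i
    raisable⇒ {q} {i} d refl (g , lg , f<g , agree) p<q with dom-below⇒ (proj₁ p<q) d
    ... | inj₂ ≤i = subst (s <ℤ_) (sym (fhat-high f ≤i)) (R<hi q (proj₁ isSucc))
    ... | inj₁ dq = ℤP.≤-<-trans (proj₂ (proj₂ isSucc) (IsLabeling.restr lg d) f<g)
      (subst (g p i <ℤ_) (trans (agree q i dq (proj₂ p<q ∘ sym)) (sym (fhat-dom f dq))) (IsLabeling.strictP lg d dq p<q))

    lowerable⇒ : ∀ {q i} → InDom S p i → f p i ≡ s → Lowerable S f p i → q <P p → fhat f q i <ℤ k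
    lowerable⇒ {q} {i} d refl (g , lg , g<f , agree) q<p with dom-above⇒ (proj₁ q<p) d
    ... | inj₁ i≤u = subst (_<ℤ k) (sym (fhat-low f i≤u)) (lo<R q k∈)
    ... | inj₂ dq  = ℤP.<-≤-trans
      (subst (_<ℤ g p i) (trans (agree q i dq (proj₂ q<p)) (sym (fhat-dom f dq))) (IsLabeling.strictP lg dq d q<p))
      (≮succ⇒≤ (IsLabeling.restr lg d) g<f)

    -- The witness raises every label of the fibre from position i₀ on to at least s.
    ⇒raisable : ∀ {i₀} → InDom S p i₀ → f p i₀ ≡ k → (∀ q → p <P q → s <ℤ fhat f q i₀) → Raisable S f p i₀
    ⇒raisable {i₀} d₀ f≡k s<f̂ =
      overwrite f p val , overwrite-labeling lf weak mem below above , raised , λ q i _ q≢p → overwrite-off f p val q≢p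
      where
      val : ℕ → ℤ
      val j = if ⌊ i₀ ≤? j ⌋ then s ℤ.⊔ f p j else f p j
      f≤val : ∀ j → f p j ≤ℤ val j
      f≤val j with i₀ ≤? j
      ... | yes _ = ℤP.i≤j⊔i s (f p j)
      ... | no _  = ℤP.≤-refl
      weak : ∀ {i j} → InDom S p i → InDom S p j → i ≤ j → val i ≤ℤ val j
      weak {i} {j} di dj i≤j with i₀ ≤? i | i₀ ≤? j
      ... | yes _    | yes _   = ℤP.⊔-monoʳ-≤ s (weakI di dj i≤j)
      ... | yes i₀≤i | no i₀≰j = contradiction (ℕP.≤-trans i₀≤i i≤j) i₀≰j
      ... | no _     | yes _   = ℤP.≤-trans (weakI di dj i≤j) (ℤP.i≤j⊔i s (f p j))
      ... | no _     | no _    = weakI di dj i≤j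
      mem : ∀ {i} → InDom S p i → val i ∈ toList (R p)
      mem {i} d with i₀ ≤? i
      ... | no _  = restr d
      ... | yes _ with ℤP.⊔-sel s (f p i)
      ...   | inj₁ e = subst (_∈ toList (R p)) (sym e) (proj₁ isSucc)
      ...   | inj₂ e = subst (_∈ toList (R p)) (sym e) (restr d)
      below : ∀ {q i} → InDom S q i → InDom S p i → q <P p → f q i <ℤ val i
      below {q} {i} dq dp q<p = ℤP.<-≤-trans (strictP dq dp q<p) (f≤val i)
      above : ∀ {q i} → InDom S p i → InDom S q i → p <P q → val i <ℤ f q i
      above {q} {i} dp dq p<q with i₀ ≤? i
      ... | no _     = strictP dp dq p<q
      ... | yes i₀≤i with ℤP.⊔-sel s (f p i)
      ...   | inj₁ e = subst₂ _<ℤ_ (sym e) (fhat-dom f dq) (ℤP.<-≤-trans (s<f̂ q p<q) (fhat-mono i₀≤i))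
      ...   | inj₂ e = subst (_<ℤ f q i) (sym e) (strictP dp dq p<q)
      raised : f p i₀ <ℤ overwrite f p val p i₀
      raised = subst₂ _<ℤ_ (sym f≡k)
        (sym (trans (overwrite-at f p val) (if-yes (isYes-reflects (i₀ ≤? i₀)) ℕP.≤-refl)))
        (ℤP.<-≤-trans (proj₁ (proj₂ isSucc)) (ℤP.i≤i⊔j s (f p i₀)))

    -- The dual witness lowers every label of the fibre up to position i₀ to at most k. The fibres
    -- below p permit this, since their labels at earlier indices are no larger than at i₀.
    ⇒lowerable : ∀ {i₀} → InDom S p i₀ → f p i₀ ≡ s → (∀ q → q <P p → fhat f q i₀ <ℤ k) → Lowerable S f p i₀
    ⇒lowerable {i₀} d₀ f≡s f̂<k =
      overwrite f p val , overwrite-labeling lf weak mem below above , lowered , λ q i _ q≢p → overwrite-off f p val q≢p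
      where
      val : ℕ → ℤ
      val j = if ⌊ j ≤? i₀ ⌋ then k ℤ.⊓ f p j else f p j
      val≤f : ∀ j → val j ≤ℤ f p j
      val≤f j with j ≤? i₀
      ... | yes _ = ℤP.i⊓j≤j k (f p j)
      ... | no _  = ℤP.≤-refl
      weak : ∀ {i j} → InDom S p i → InDom S p j → i ≤ j → val i ≤ℤ val j
      weak {i} {j} di dj i≤j with i ≤? i₀ | j ≤? i₀
      ... | yes _   | yes _    = ℤP.⊓-monoʳ-≤ k (weakI di dj i≤j)
      ... | no i≰i₀ | yes j≤i₀ = contradiction (ℕP.≤-trans i≤j j≤i₀) i≰i₀
      ... | yes _   | no _     = ℤP.≤-trans (ℤP.i⊓j≤j k (f p i)) (weakI di dj i≤j)
      ... | no _    | no _     = weakI di dj i≤j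
      mem : ∀ {i} → InDom S p i → val i ∈ toList (R p)
      mem {i} d with i ≤? i₀
      ... | no _  = restr d
      ... | yes _ with ℤP.⊓-sel k (f p i)
      ...   | inj₁ e = subst (_∈ toList (R p)) (sym e) k∈
      ...   | inj₂ e = subst (_∈ toList (R p)) (sym e) (restr d)
      above : ∀ {q i} → InDom S p i → InDom S q i → p <P q → val i <ℤ f q i
      above {q} {i} dp dq p<q = ℤP.≤-<-trans (val≤f i) (strictP dp dq p<q)
      below : ∀ {q i} → InDom S q i → InDom S p i → q <P p → f q i <ℤ val i
      below {q} {i} dq dp q<p with i ≤? i₀
      ... | no _     = strictP dq dp q<p
      ... | yes i≤i₀ with ℤP.⊓-sel k (f p i)
      ...   | inj₁ e = subst₂ _<ℤ_ (fhat-dom f dq) (sym e) (ℤP.≤-<-trans (fhat-mono i≤i₀) (f̂<k q q<p))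
      ...   | inj₂ e = subst (f q i <ℤ_) (sym e) (strictP dq dp q<p)
      lowered : overwrite f p val p i₀ <ℤ f p i₀
      lowered = subst₂ _<ℤ_
        (sym (trans (overwrite-at f p val) (if-yes (isYes-reflects (i₀ ≤? i₀)) ℕP.≤-refl))) (sym f≡s)
        (ℤP.≤-<-trans (ℤP.i⊓j≤i k (f p i₀)) (proj₁ (proj₂ isSucc)))

  -- The action of ρ k on one fibre

  Active : ℤ → Fin n → Set
  Active k p = k ∈ toList (R p) × k ≢ maxL (R p)

  active-reflects : ∀ k p → Reflects (Active k p) ((k ∈ᵇ toList (R p)) ∧ not ⌊ k ℤP.≟ maxL (R p) ⌋)
  active-reflects k p = ∈ᵇ-reflects k (toList (R p)) ×-reflects ¬-reflects (isYes-reflects (k ℤP.≟ maxL (R p)))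

  active? : ∀ k p → Dec (Active k p)
  active? k p = Any.any? (k ℤP.≟_) (toList (R p)) ×-dec ¬? (k ℤP.≟ maxL (R p))

  active⇒succ : ∀ {k p} → Active k p → ∃ (IsSucc (toList (R p)) k)
  active⇒succ {k} {p} (k∈ , k≢max) with Maxℤ.foldr₁-extremum (R p)
  ... | m∈ , ≤m = succ-exists m∈ (ℤP.≤∧≢⇒< (≤m k∈) k≢max)

  ρ-inactive : ∀ {k p} f i → ¬ Active k p → ρ k f p i ≡ f p i
  ρ-inactive {k} {p} f i ¬active = if-no (active-reflects k p ×-reflects T-reflects _) (¬active ∘ proj₁)

  inDom? : ∀ p i → Dec (InDom S p i)
  inDom? p i = (u p <? i) ×-dec (i <? suc ℓ ∸ v p)

  module Fibre (f : Lab S) {p : Fin n} {k s : ℤ}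
               (k∈ : k ∈ toList (R p)) (isSucc : IsSucc (toList (R p)) k s) where

    k<s : k <ℤ s
    k<s = proj₁ (proj₂ isSucc)

    active : Active k p
    active = k∈ , λ { refl → ℤP.<⇒≱ k<s (proj₂ (Maxℤ.foldr₁-extremum (R p)) (proj₁ isSucc)) }

    Free : ℕ → Set
    Free i = InDom S p i × ((f p i ≡ k × Raisable S f p i) ⊎ (f p i ≡ s × Lowerable S f p i))

    free? : Decidable Free
    free? i = inDom? p i ×-dec
      (((f p i ℤP.≟ k) ×-dec raise? f p i) ⊎-dec ((f p i ℤP.≟ s) ×-dec lower? f p i))

    top? : Decidable (λ i → f p i ≡ s)
    top? i = f p i ℤP.≟ s

    rank : ℕ → ℕ
    rank = # free?

    b : ℕ
    b = # (λ i → free? i ×-dec top? i) ℓ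

    top-reflects : ∀ i → Reflects (f p i ≡ s) (succIn (R p) k ==ᵐ f p i)
    top-reflects i = reflects-map (succIn-reflects (R p) k (f p i))
      (λ isSucc′ → succ-unique isSucc′ isSucc) (λ e → subst (IsSucc (toList (R p)) k) (sym e) isSucc)

    -- A copy of the test local to `ρ`, which cannot be named from outside; the lemmas below match
    -- the two by unfolding.
    freeᵇ : ℕ → Bool
    freeᵇ i = InDomᵇ S p i ∧
      ((⌊ f p i ℤP.≟ k ⌋ ∧ ⌊ raise? f p i ⌋) ∨ ((succIn (R p) k ==ᵐ f p i) ∧ ⌊ lower? f p i ⌋))

    free-reflects : ∀ i → Reflects (Free i) (freeᵇ i)
    free-reflects i = InDomᵇ-reflects p i ×-reflects
      ((isYes-reflects (f p i ℤP.≟ k) ×-reflects isYes-reflects (raise? f p i)) ⊎-reflects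
       (top-reflects i ×-reflects isYes-reflects (lower? f p i)))

    ρ-fixed : ∀ {i} → ¬ Free i → ρ k f p i ≡ f p i
    ρ-fixed {i} ¬free = if-no (active-reflects k p ×-reflects free-reflects i) (¬free ∘ proj₂)

    rank≤b-reflects : ∀ i → Reflects (rank i ≤ b)
      (countᵇ freeᵇ (range1 i) ≤ᵇ countᵇ (λ j → freeᵇ j ∧ (succIn (R p) k ==ᵐ f p j)) (range1 ℓ))
    rank≤b-reflects i = reflects-map (ℕP.≤ᵇ-reflects-≤ _ _) (subst₂ _≤_ rank≡ b≡) (subst₂ _≤_ (sym rank≡) (sym b≡))
      where
      rank≡ : countᵇ freeᵇ (range1 i) ≡ rank i
      rank≡ = countᵇ-range1 free? free-reflects i
      b≡ : countᵇ (λ j → freeᵇ j ∧ (succIn (R p) k ==ᵐ f p j)) (range1 ℓ) ≡ b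
      b≡ = countᵇ-range1 (λ i → free? i ×-dec top? i) (λ i → free-reflects i ×-reflects top-reflects i) ℓ

    ρ-low : ∀ {i} → Free i → rank i ≤ b → ρ k f p i ≡ k
    ρ-low {i} free r≤b = trans (if-yes (active-reflects k p ×-reflects free-reflects i) (active , free))
                               (if-yes (rank≤b-reflects i) r≤b)

    ρ-high : ∀ {i} → Free i → ¬ rank i ≤ b → ρ k f p i ≡ s
    ρ-high {i} free r≰b = trans (if-yes (active-reflects k p ×-reflects free-reflects i) (active , free))
      (trans (if-no (rank≤b-reflects i) r≰b)
             (fromMaybe-==ᵐ (succIn (R p) k) (⇒T (succIn-reflects (R p) k s) isSucc)))

    rank-mono : ∀ {i j} → i ≤ j → rank i ≤ rank j
    rank-mono {i} {j} i≤j with ℕP.m≤n⇒m<n∨m≡n i≤j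
    ... | inj₂ refl = ℕP.≤-refl
    rank-mono {i} {suc j} i≤j | inj₁ i<j = ℕP.≤-trans (rank-mono (ℕP.≤-pred i<j)) (step j)
      where
      step : ∀ j → rank j ≤ rank (suc j)
      step j with does (free? (suc j))
      ... | true  = ℕP.n≤1+n _
      ... | false = ℕP.≤-refl

    module _ (lf : IsLabeling S f) where
      open IsLabeling lf

      -- Free positions are consecutive: the witness that raises one k raises every later k, and the
      -- witness that lowers one s lowers every earlier s. So a fixed label after a free one is at
      -- least s, and a fixed label before it is at most k.
      ρ-weak : ∀ {i j} → InDom S p i → InDom S p j → i ≤ j → ρ k f p i ≤ℤ ρ k f p j
      ρ-weak {i} {j} di dj i≤j with free? i | free? j
      ... | no ¬fi | no ¬fj = subst₂ _≤ℤ_ (sym (ρ-fixed ¬fi)) (sym (ρ-fixed ¬fj)) (weakI di dj i≤j)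
      ... | yes fi | yes fj with rank i ≤? b | rank j ≤? b
      ...   | yes ri | yes rj = ℤP.≤-reflexive (trans (ρ-low fi ri) (sym (ρ-low fj rj)))
      ...   | yes ri | no rj  = subst₂ _≤ℤ_ (sym (ρ-low fi ri)) (sym (ρ-high fj rj)) (ℤP.<⇒≤ k<s)
      ...   | no ri  | yes rj = contradiction (ℕP.≤-trans (rank-mono i≤j) rj) ri
      ...   | no ri  | no rj  = ℤP.≤-reflexive (trans (ρ-high fi ri) (sym (ρ-high fj rj)))
      ρ-weak {i} {j} di dj i≤j | yes fi | no ¬fj =
        ℤP.≤-trans ρ≤s (subst (s ≤ℤ_) (sym (ρ-fixed ¬fj)) (s≤f (proj₂ fi)))
        where
        ρ≤s : ρ k f p i ≤ℤ s
        ρ≤s with rank i ≤? b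
        ... | yes r = subst (_≤ℤ s) (sym (ρ-low fi r)) (ℤP.<⇒≤ k<s)
        ... | no r  = ℤP.≤-reflexive (ρ-high fi r)
        s≤f : _ → s ≤ℤ f p j
        s≤f (inj₂ (f≡s , _)) = subst (_≤ℤ f p j) f≡s (weakI di dj i≤j)
        s≤f (inj₁ (f≡k , g , lg , f<g , agree)) with f p j ℤP.≟ k
        ... | no fj≢k = proj₂ (proj₂ isSucc) (restr dj)
          (ℤP.≤∧≢⇒< (subst (_≤ℤ f p j) f≡k (weakI di dj i≤j)) (fj≢k ∘ sym))
        ... | yes fj≡k = contradiction
          (dj , inj₁ (fj≡k , g , lg ,
            subst (_<ℤ g p j) (trans f≡k (sym fj≡k)) (ℤP.<-≤-trans f<g (IsLabeling.weakI lg di dj i≤j)) , agree)) ¬fj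
      ρ-weak {i} {j} di dj i≤j | no ¬fi | yes fj =
        ℤP.≤-trans (subst (_≤ℤ k) (sym (ρ-fixed ¬fi)) (f≤k (proj₂ fj))) k≤ρ
        where
        k≤ρ : k ≤ℤ ρ k f p j
        k≤ρ with rank j ≤? b
        ... | yes r = ℤP.≤-reflexive (sym (ρ-low fj r))
        ... | no r  = subst (k ≤ℤ_) (sym (ρ-high fj r)) (ℤP.<⇒≤ k<s)
        f≤k : _ → f p i ≤ℤ k
        f≤k (inj₁ (f≡k , _)) = subst (f p i ≤ℤ_) f≡k (weakI di dj i≤j)
        f≤k (inj₂ (f≡s , g , lg , g<f , agree)) with f p i ℤP.≟ s
        ... | no fi≢s = ≮succ⇒≤ lf k∈ isSucc (restr di)
          (ℤP.≤∧≢⇒< (subst (f p i ≤ℤ_) f≡s (weakI di dj i≤j)) fi≢s)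
        ... | yes fi≡s = contradiction
          (di , inj₂ (fi≡s , g , lg ,
            subst (g p i <ℤ_) (trans f≡s (sym fi≡s)) (ℤP.≤-<-trans (IsLabeling.weakI lg di dj i≤j) g<f) , agree)) ¬fi

  -- Forgets ranks and keeps only why a changed label was free. `same` includes the free labels that
  -- are rewritten to their old value.
  data Step (k : ℤ) (f : Lab S) (p : Fin n) (i : ℕ) : Set where
    same : ρ k f p i ≡ f p i → Step k f p i
    up   : ∀ {s} → k ∈ toList (R p) → IsSucc (toList (R p)) k s →
           f p i ≡ k → Raisable S f p i → ρ k f p i ≡ s → Step k f p i
    down : ∀ {s} → k ∈ toList (R p) → IsSucc (toList (R p)) k s →
           f p i ≡ s → Lowerable S f p i → ρ k f p i ≡ k → Step k f p i

  step : ∀ k f p i → Step k f p i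
  step k f p i with active? k p
  ... | no ¬act = same (ρ-inactive f i ¬act)
  ... | yes act@(k∈ , _) with active⇒succ act
  ...   | s , isSucc with Fibre.free? f k∈ isSucc i
  ...     | no ¬free = same (Fibre.ρ-fixed f k∈ isSucc ¬free)
  ...     | yes free@(_ , kind) with Fibre.rank f k∈ isSucc i ≤? Fibre.b f k∈ isSucc | kind
  ...       | yes r | inj₁ (f≡k , _) = same (trans (Fibre.ρ-low f k∈ isSucc free r) (sym f≡k))
  ...       | yes r | inj₂ (f≡s , l) = down k∈ isSucc f≡s l (Fibre.ρ-low f k∈ isSucc free r)
  ...       | no r  | inj₁ (f≡k , l) = up k∈ isSucc f≡k l (Fibre.ρ-high f k∈ isSucc free r)
  ...       | no r  | inj₂ (f≡s , _) = same (trans (Fibre.ρ-high f k∈ isSucc free r) (sym f≡s))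

  module _ {f : Lab S} (lf : IsLabeling S f) (k : ℤ) where
    open Labeling lf
    open IsLabeling lf

    -- All fibres change at once, so both labels of a comparable pair may move. Over a raised k at p
    -- all labels exceed its successor in `R p`; under a label lowered to k all labels are less than
    -- k. With strictness of f, this settles or excludes every combination.
    ρ-strict : ∀ {p q i} → InDom S p i → InDom S q i → p <P q → ρ k f p i <ℤ ρ k f q i
    ρ-strict {p} {q} {i} dp dq p<q with step k f p i | step k f q i
    ... | same e | same e′ = subst₂ _<ℤ_ (sym e) (sym e′) (strictP dp dq p<q)
    ... | same e | up k∈ sc f≡k _ e′ = subst₂ _<ℤ_ (sym e) (sym e′)
      (ℤP.<-trans (subst (f p i <ℤ_) f≡k (strictP dp dq p<q)) (proj₁ (proj₂ sc)))
    ... | same e | down k∈ sc f≡s l e′ = subst₂ _<ℤ_ (sym e) (sym e′)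
      (subst (_<ℤ k) (fhat-dom f dp) (lowerable⇒ lf k∈ sc dq f≡s l p<q))
    ... | up k∈ sc f≡k l e | same e′ = subst₂ _<ℤ_ (sym e) (sym e′)
      (subst (_ <ℤ_) (fhat-dom f dq) (raisable⇒ lf k∈ sc dp f≡k l p<q))
    ... | up _ _ fp≡k _ _ | up _ _ fq≡k _ _ = contradiction (strictP dp dq p<q) (ℤP.<-irrefl (trans fp≡k (sym fq≡k)))
    ... | up _ _ f≡k _ _ | down k∈ sc f≡s l _ = contradiction
      (subst (_<ℤ k) (trans (fhat-dom f dp) f≡k) (lowerable⇒ lf k∈ sc dq f≡s l p<q)) (ℤP.<-irrefl refl)
    ... | down _ sc f≡s _ e | same e′ = subst₂ _<ℤ_ (sym e) (sym e′)
      (ℤP.<-trans (proj₁ (proj₂ sc)) (subst (_<ℤ f q i) f≡s (strictP dp dq p<q)))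
    ... | down _ _ _ _ e | up _ sc _ _ e′ = subst₂ _<ℤ_ (sym e) (sym e′) (proj₁ (proj₂ sc))
    ... | down _ sc f≡s _ _ | down k∈ sc′ f≡s′ l _ = contradiction
      (subst (_<ℤ k) (trans (fhat-dom f dp) f≡s) (lowerable⇒ lf k∈ sc′ dq f≡s′ l p<q))
      (ℤP.<-asym (proj₁ (proj₂ sc)))

    ρ-labeling : IsLabeling S (ρ k f)
    ρ-labeling = record { strictP = ρ-strict ; weakI = weak ; restr = member }
      where
      weak : ∀ {p i j} → InDom S p i → InDom S p j → i ≤ j → ρ k f p i ≤ℤ ρ k f p j
      weak {p} {i} {j} di dj i≤j with active? k p
      ... | no ¬act = subst₂ _≤ℤ_ (sym (ρ-inactive f i ¬act)) (sym (ρ-inactive f j ¬act)) (weakI di dj i≤j)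
      ... | yes act = Fibre.ρ-weak f (proj₁ act) (proj₂ (active⇒succ act)) lf di dj i≤j
      member : ∀ {p i} → InDom S p i → ρ k f p i ∈ toList (R p)
      member {p} {i} d with step k f p i
      ... | same e            = subst (_∈ toList (R p)) (sym e) (restr d)
      ... | up _ sc _ _ e     = subst (_∈ toList (R p)) (sym e) (proj₁ sc)
      ... | down k∈ _ _ _ e   = subst (_∈ toList (R p)) (sym e) k∈

    -- `ρ k` only exchanges k with its successor, and among the thresholds in `R̂ p` only k
    -- separates these two.
    Φ-ρ-off : ∀ {p j} → InΓ (p , j) → j ≢ k → Φ (ρ k f) (p , j) ≡ Φ f (p , j)
    Φ-ρ-off {p} {j} (j∈ , j<hi) j≢k = trans (Φ-# (ρ k f) p j) (trans
      (#-cong (exceeds? (ρ k f) p j) (exceeds? f p j) ℓ λ {i} _ _ → compare i) (sym (Φ-# f p j)))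
      where
      compare : ∀ i → (j <ℤ fhat (ρ k f) p i → j <ℤ fhat f p i) × (j <ℤ fhat f p i → j <ℤ fhat (ρ k f) p i)
      compare i with position p i
      ... | low i≤u = subst (j <ℤ_) (trans (fhat-low (ρ k f) i≤u) (sym (fhat-low f i≤u)))
                    , subst (j <ℤ_) (trans (fhat-low f i≤u) (sym (fhat-low (ρ k f) i≤u)))
      ... | high ≤i = subst (j <ℤ_) (trans (fhat-high (ρ k f) ≤i) (sym (fhat-high f ≤i)))
                    , subst (j <ℤ_) (trans (fhat-high f ≤i) (sym (fhat-high (ρ k f) ≤i)))
      ... | dom d   = subst₂ (λ x y → (j <ℤ x → j <ℤ y) × (j <ℤ y → j <ℤ x))
                             (sym (fhat-dom (ρ k f) d)) (sym (fhat-dom f d)) (labels (step k f p i))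
        where
        below-succ : ∀ {s} → k ∈ toList (R p) → IsSucc (toList (R p)) k s → j <ℤ s → j <ℤ k
        below-succ k∈ sc j<s = ℤP.≤∧≢⇒< (ℤP.≮⇒≥ λ k<j →
          ℤP.<⇒≱ j<s (proj₂ (proj₂ (succ-R̂ k∈ sc)) j∈ k<j)) j≢k
        labels : Step k f p i → (j <ℤ ρ k f p i → j <ℤ f p i) × (j <ℤ f p i → j <ℤ ρ k f p i)
        labels (same e) = subst (j <ℤ_) e , subst (j <ℤ_) (sym e)
        labels (up k∈ sc f≡k _ e) =
          (λ j<ρ → subst (j <ℤ_) (sym f≡k) (below-succ k∈ sc (subst (j <ℤ_) e j<ρ))) ,
          (λ j<f → subst (j <ℤ_) (sym e) (ℤP.<-trans (subst (j <ℤ_) f≡k j<f) (proj₁ (proj₂ sc))))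
        labels (down k∈ sc f≡s _ e) =
          (λ j<ρ → subst (j <ℤ_) (sym f≡s) (ℤP.<-trans (subst (j <ℤ_) e j<ρ) (proj₁ (proj₂ sc)))) ,
          (λ j<f → subst (j <ℤ_) (sym e) (below-succ k∈ sc (subst (j <ℤ_) f≡s j<f)))

  Φ-ρ-inactive : ∀ {k p j} f → ¬ Active k p → Φ (ρ k f) (p , j) ≡ Φ f (p , j)
  Φ-ρ-inactive {k} {p} {j} f ¬act = trans (Φ-# (ρ k f) p j) (trans
    (#-cong (exceeds? (ρ k f) p j) (exceeds? f p j) ℓ λ {i} _ _ →
      subst (j <ℤ_) (hats i) , subst (j <ℤ_) (sym (hats i)))
    (sym (Φ-# f p j)))
    where
    hats : ∀ i → fhat (ρ k f) p i ≡ fhat f p i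
    hats i = fhat-cong (ρ k f) f (ρ-inactive f i ¬act)

-- Equivariance

module Equivariance (S : Setting) (h h̃ : Fin (Setting.n S) → ℕ)
  (isHeight : ∀ p → IsHeight S p (h p)) (isCoheight : ∀ p → IsCoheight S p (h̃ p))
  (u+v≤ℓ : ∀ p → Setting.u S p + Setting.v S p ≤ Setting.ℓ S)
  (uv-mono : ∀ p₁ p₂ → Setting._≤P_ S p₁ p₂ →
     Setting.v S p₁ ≤ Setting.v S p₂ × Setting.u S p₂ ≤ Setting.u S p₁)
  (raise? : ∀ f p i → Dec (Raisable S f p i)) (lower? : ∀ f p i → Dec (Lowerable S f p i)) where
  open Setting S
  open BenderKnuth S h h̃ isHeight isCoheight u+v≤ℓ uv-mono raise? lower? public
  open Hat S h h̃
  open Promotion S raise? lower?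
  open GammaDefs leqᵇ R using () renaming (minAll to minR; maxAll to maxR)

  upperValue lowerValue toggled : QPart → Fin n → ℤ → ℕ
  upperValue σ p k = minℕ ℓ (map σ (filterᵇ (λ y → coverΓ (p , k) y) Γlist))
  lowerValue σ p k = maxℕ (map σ (filterᵇ (λ z → coverΓ z (p , k)) Γlist))
  toggled σ p k = (upperValue σ p k + lowerValue σ p k) ∸ σ (p , k)

  -- Equivariance may fail off Γ: a threshold strictly between two neighbouring elements of `R̂ p`
  -- sees the counts change under `ρ`, but no toggle touches it.
  _≈Γ_ : QPart → QPart → Set
  σ ≈Γ σ′ = ∀ {x} → InΓ x → σ x ≡ σ′ x

  module ActiveFibre {f : Lab S} (lf : IsLabeling S f) {p : Fin n} {k s : ℤ}
    (k∈ : k ∈ toList (R p)) (isSucc : IsSucc (toList (R p)) k s) where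
    open Labeling lf
    open IsLabeling lf
    open Fibre f k∈ isSucc

    -- The sizes of `Up` and `Down` will be the minimum over the upper covers and the maximum over
    -- the lower covers of (p , k).
    X Up Down : ℕ → Set
    X i = k <ℤ fhat f p i
    Up i = X i ⊎ (InDom S p i × f p i ≡ k × Raisable S f p i)
    Down i = X i × ¬ (InDom S p i × f p i ≡ s × Lowerable S f p i)

    x? : Decidable X
    x? = exceeds? f p k

    raised? : Decidable (λ i → InDom S p i × f p i ≡ k × Raisable S f p i)
    raised? i = inDom? p i ×-dec (f p i ℤP.≟ k) ×-dec raise? f p i

    lowered? : Decidable (λ i → InDom S p i × f p i ≡ s × Lowerable S f p i)
    lowered? i = inDom? p i ×-dec (f p i ℤP.≟ s) ×-dec lower? f p i

    up? : Decidable Up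
    up? i = x? i ⊎-dec raised? i

    down? : Decidable Down
    down? i = x? i ×-dec ¬? (lowered? i)

    a : ℕ
    a = # raised? ℓ

    f≡k⇒¬X : ∀ {i} → InDom S p i → f p i ≡ k → ¬ X i
    f≡k⇒¬X d f≡k = ℤP.<-irrefl (sym (trans (fhat-dom f d) f≡k))

    f≡s⇒f≢k : ∀ {i} → f p i ≡ s → f p i ≢ k
    f≡s⇒f≢k f≡s f≡k = ℤP.<-irrefl (trans (sym f≡k) f≡s) k<s

    #up : # up? ℓ ≡ # x? ℓ + a
    #up = trans (#-split up? x? ℓ) (cong₂ _+_
      (#-cong (λ i → up? i ×-dec x? i) x? ℓ λ _ _ → proj₂ , λ x → inj₁ x , x)
      (#-cong (λ i → up? i ×-dec ¬? (x? i)) raised? ℓ λ _ _ →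
        (λ { (inj₁ x , ¬x) → contradiction x ¬x ; (inj₂ r , _) → r }) ,
        (λ r@(d , f≡k , _) → inj₂ r , f≡k⇒¬X d f≡k)))

    #free : # free? ℓ ≡ b + a
    #free = trans (#-split free? top? ℓ) (cong (λ m → b + m)
      (#-cong (λ i → free? i ×-dec ¬? (top? i)) raised? ℓ λ _ _ →
        (λ { ((d , inj₁ (f≡k , r)) , _)     → d , f≡k , r
           ; ((d , inj₂ (f≡s , _)) , f≢s) → contradiction f≡s f≢s }) ,
        (λ (d , f≡k , r) → (d , inj₁ (f≡k , r)) , λ f≡s → f≡s⇒f≢k f≡s f≡k)))

    low? : Decidable (λ i → rank i ≤ b)
    low? i = rank i ≤? b

    -- Of the b + a free positions, the first b receive k.
    #free-high : # (λ i → free? i ×-dec ¬? (low? i)) ℓ ≡ a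
    #free-high = ℕP.+-cancelˡ-≡ b _ a (begin
      b + # (λ i → free? i ×-dec ¬? (low? i)) ℓ
        ≡⟨ cong (_+ # (λ i → free? i ×-dec ¬? (low? i)) ℓ)
             (trans (#-rank free? b ℓ) (ℕP.m≤n⇒m⊓n≡m (subst (b ≤_) (sym #free) (ℕP.m≤m+n b a)))) ⟨
      # (λ i → free? i ×-dec low? i) ℓ + # (λ i → free? i ×-dec ¬? (low? i)) ℓ ≡⟨ #-split free? low? ℓ ⟨
      # free? ℓ ≡⟨ #free ⟩
      b + a ∎)
      where open ≡-Reasoning

    -- After `ρ` the labels above k are the a free ones set to s and the fixed ones above k. The
    -- latter form `Down`, which already omits the lowerable labels, so b need not be subtracted.
    #ρ : # (exceeds? (ρ k f) p k) ℓ ≡ a + # down? ℓ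
    #ρ = trans (#-split (exceeds? (ρ k f) p k) free? ℓ) (cong₂ _+_
      (trans (#-cong (λ i → exceeds? (ρ k f) p k i ×-dec free? i) (λ i → free? i ×-dec ¬? (low? i)) ℓ λ _ _ →
        (λ (k<ρ , free) → free , λ r → ℤP.<-irrefl (sym (trans (fhat-dom (ρ k f) (proj₁ free)) (ρ-low free r))) k<ρ) ,
        (λ (free , r) → subst (k <ℤ_) (sym (trans (fhat-dom (ρ k f) (proj₁ free)) (ρ-high free r))) k<s , free))
        #free-high)
      (#-cong (λ i → exceeds? (ρ k f) p k i ×-dec ¬? (free? i)) down? ℓ λ {i} _ _ →
        (λ (k<ρ , ¬free) → subst (k <ℤ_) (hats i ¬free) k<ρ , λ (d , f≡s , l) → ¬free (d , inj₂ (f≡s , l))) ,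
        (λ (x , ¬l) → subst (k <ℤ_) (sym (hats i (¬free x ¬l))) x , ¬free x ¬l)))
      where
      hats : ∀ i → ¬ Free i → fhat (ρ k f) p i ≡ fhat f p i
      hats i ¬free = fhat-cong (ρ k f) f (ρ-fixed ¬free)
      ¬free : ∀ {i} → X i → ¬ (InDom S p i × f p i ≡ s × Lowerable S f p i) → ¬ Free i
      ¬free x ¬l (d , inj₁ (f≡k , _)) = f≡k⇒¬X d f≡k x
      ¬free x ¬l (d , inj₂ (f≡s , l)) = ¬l (d , f≡s , l)

    R̂-succ : IsSucc (toList (R̂ p)) k s
    R̂-succ = succ-R̂ k∈ isSucc

    X⇒s≤ : ∀ i → X i → s ≤ℤ fhat f p i
    X⇒s≤ i = proj₂ (proj₂ R̂-succ) (fhat-∈ p i)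

    k∈Γ : InΓ (p , k)
    k∈Γ = R⊆Γ k∈

    f̂≡⇒dom : ∀ {i x} → x ∈ toList (R p) → fhat f p i ≡ x → InDom S p i × f p i ≡ x
    f̂≡⇒dom {i} x∈ refl = d , sym (fhat-dom f d)
      where
      d : InDom S p i
      d = fhat∈R⇒dom f x∈

    -- A cover in another fibre has k₂ ≤ s, and an index in `Up` forces the label of q above s, by
    -- strictness or by raisability.
    up-⊆ : ∀ {q k₂ i} → (p , k) ⋖Γ (q , k₂) → Up i → k₂ <ℤ fhat f q i
    up-⊆ (_ , _ , inj₁ (refl , _ , k₂<k , _)) (inj₁ x) = ℤP.<-trans k₂<k x
    up-⊆ (_ , _ , inj₁ (refl , _ , k₂<k , _)) (inj₂ (d , f≡k , _)) =
      subst (_ <ℤ_) (sym (trans (fhat-dom f d) f≡k)) k₂<k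
    up-⊆ {q} {k₂} {i} (_ , _ , inj₂ (p⋖q , (_ , _ , ≤k) , _)) u = ℤP.≤-<-trans
        (ℤP.≮⇒≥ λ s<k₂ → ℤP.<⇒≱ k<s (≤k (proj₁ R̂-succ) s<k₂)) (s<f̂ u)
      where
      s<f̂ : Up i → s <ℤ fhat f q i
      s<f̂ (inj₁ x)             = ℤP.≤-<-trans (X⇒s≤ i x) (fhat-strict {i = i} (proj₁ p⋖q))
      s<f̂ (inj₂ (d , f≡k , r)) = raisable⇒ lf k∈ isSucc d f≡k r (proj₁ p⋖q)

    -- The lower padding guarantees that k has a predecessor in `R̂ p`, hence that (p , k) has an
    -- upper cover in its own fibre.
    pred-cover : ∃ λ k⁻ → (p , k) ⋖Γ (p , k⁻) × IsPred (toList (R̂ p)) k k⁻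
    pred-cover with pred-exists lo∈R̂ (lo<R p k∈)
    ... | k⁻ , isPred@(k⁻∈ , k⁻<k , ≤k⁻) = k⁻ ,
      (k∈Γ , (k⁻∈ , ℤP.<-trans k⁻<k (proj₂ k∈Γ)) ,
       inj₁ (refl , R⊆R̂ k∈ , k⁻<k , λ x∈ k⁻<x → ℤP.≮⇒≥ λ x<k → ℤP.<⇒≱ k⁻<x (≤k⁻ x∈ x<k))) , isPred

    blocking-cover : ∀ {i} → InDom S p i → f p i ≡ k → ¬ Raisable S f p i →
      ∃ λ q → p ⋖ q × fhat f q i ≤ℤ s
    blocking-cover {i} d f≡k ¬r with FinP.any? (λ q → (p <P? q) ×-dec (fhat f q i ℤP.≤? s))
    ... | no none = contradiction
      (⇒raisable lf k∈ isSucc d f≡k λ q p<q → ℤP.≰⇒> λ f̂≤s → none (q , p<q , f̂≤s)) ¬r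
    ... | yes (q , p<q , f̂≤s) with proj₁ (cover-between p<q)
    ...   | r , p⋖r , r≤q = r , p⋖r , ℤP.≤-trans (fhat-mono-≤P {i = i} r≤q) f̂≤s

    supporting-cover : ∀ {i} → InDom S p i → f p i ≡ s → ¬ Lowerable S f p i →
      ∃ λ q → q ⋖ p × k ≤ℤ fhat f q i
    supporting-cover {i} d f≡s ¬l with FinP.any? (λ q → (q <P? p) ×-dec (k ℤP.≤? fhat f q i))
    ... | no none = contradiction
      (⇒lowerable lf k∈ isSucc d f≡s λ q q<p → ℤP.≰⇒> λ k≤f̂ → none (q , q<p , k≤f̂)) ¬l
    ... | yes (q , q<p , k≤f̂) with proj₂ (cover-between q<p)
    ...   | r , q≤r , r⋖p = r , r⋖p , ℤP.≤-trans k≤f̂ (fhat-mono-≤P {i = i} q≤r)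

    -- Let i₀ be the last index outside `Up`; it suffices to find a cover whose threshold is not
    -- exceeded at i₀. If the label of p there is not k, it is at most k⁻. If it is k, it is not
    -- raisable, and a blocking cover of p provides the threshold.
    up-attained : ∃ λ y → (p , k) ⋖Γ y × Φ f y ≤ # up? ℓ
    up-attained with last-failure up? ℓ
    -- When every index lies in `Up` the bound is trivial, and any upper cover serves.
    ... | inj₁ all with pred-cover
    ...   | k⁻ , c , _ = (p , k⁻) , c , subst (_≤ # up? ℓ) (sym (Φ-# f p k⁻))
                           (#-mono (exceeds? f p k⁻) up? ℓ λ 1≤i i≤ℓ _ → all 1≤i i≤ℓ)
    up-attained | inj₂ (i₀ , ¬up , after) = attained (fhat f p i₀ ℤP.≟ k)
      where
      bound : ∀ {q k₂} → fhat f q i₀ ≤ℤ k₂ → Φ f (q , k₂) ≤ # up? ℓ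
      bound {q} {k₂} f̂≤k₂ = subst (_≤ # up? ℓ) (sym (Φ-# f q k₂))
        (#-mono (exceeds? f q k₂) up? ℓ λ {i} _ i≤ℓ k₂<f̂ → after
          (ℕP.≰⇒> λ i≤i₀ → ℤP.<⇒≱ k₂<f̂ (ℤP.≤-trans (fhat-mono i≤i₀) f̂≤k₂)) i≤ℓ)
      attained : Dec (fhat f p i₀ ≡ k) → ∃ λ y → (p , k) ⋖Γ y × Φ f y ≤ # up? ℓ
      attained (no f̂≢k) with pred-cover
      ... | k⁻ , c , (_ , _ , ≤k⁻) = (p , k⁻) , c ,
        bound (≤k⁻ (fhat-∈ p i₀) (ℤP.≤∧≢⇒< (ℤP.≮⇒≥ (¬up ∘ inj₁)) f̂≢k))
      attained (yes f̂≡k) with f̂≡⇒dom k∈ f̂≡k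
      ... | d , f≡k with blocking-cover d f≡k (λ r → ¬up (inj₂ (d , f≡k , r)))
      -- The largest element of `R̂ q` up to s is the largest one whose predecessor in `R̂ p` is k,
      -- as the cover relation demands.
      ...   | q , p⋖q , f̂≤s with Maxℤ.extremum-of (ℤP._≤? s) (fhat-∈ q i₀) f̂≤s
      ...     | k₂ , k₂∈ , k₂≤s , ≤k₂ = (q , k₂) ,
        ( k∈Γ , (k₂∈ , ℤP.≤-<-trans k₂≤s (R<hi q (proj₁ isSucc)))
        , inj₂ (p⋖q , (R⊆R̂ k∈ , k<k₂ , λ x∈ x<k₂ → below x∈ (ℤP.<-≤-trans x<k₂ k₂≤s))
               , <hi⇒≢maxL p (proj₂ k∈Γ) , maximal)) ,
        bound (≤k₂ (fhat-∈ q i₀) f̂≤s)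
        where
        k<k₂ : k <ℤ k₂
        k<k₂ = ℤP.<-≤-trans (subst (_<ℤ fhat f q i₀) f̂≡k (fhat-strict {i = i₀} (proj₁ p⋖q))) (≤k₂ (fhat-∈ q i₀) f̂≤s)
        below : ∀ {x} → x ∈ toList (R̂ p) → x <ℤ s → x ≤ℤ k
        below x∈ x<s = ℤP.≮⇒≥ λ k<x → ℤP.<⇒≱ x<s (proj₂ (proj₂ R̂-succ) x∈ k<x)
        maximal : ¬ Any (λ j → k₂ <ℤ j × IsPred (toList (R̂ p)) j k) (toList (R̂ q))
        maximal some with find some
        ... | j , j∈ , k₂<j , (_ , _ , ≤k) = ℤP.<⇒≱ k₂<j
          (≤k₂ j∈ (ℤP.≮⇒≥ λ s<j → ℤP.<⇒≱ k<s (≤k (proj₁ R̂-succ) s<j)))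

    -- Between fibres, k₁ is the predecessor of k in `R̂ q`, so the label of q is at least k.
    -- Strictness then puts the label of p above k, and a lowerable s is ruled out.
    down-⊇ : ∀ {q k₁ i} → (q , k₁) ⋖Γ (p , k) → k₁ <ℤ fhat f q i → Down i
    down-⊇ (_ , _ , inj₁ (refl , k₁∈ , k<k₁ , _)) k₁<f̂ = ℤP.<-trans k<k₁ k₁<f̂ ,
      λ (d , f≡s , _) → ℤP.<⇒≱ (subst (_ <ℤ_) (trans (fhat-dom f d) f≡s) k₁<f̂) (proj₂ (proj₂ R̂-succ) k₁∈ k<k₁)
    down-⊇ {q} {k₁} {i} (_ , _ , inj₂ (q⋖p , (_ , _ , ≤k₁) , _)) k₁<f̂ =
      ℤP.≤-<-trans k≤f̂ (fhat-strict {i = i} (proj₁ q⋖p)) ,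
      λ (d , f≡s , l) → ℤP.<⇒≱ (lowerable⇒ lf k∈ isSucc d f≡s l (proj₁ q⋖p)) k≤f̂
      where
      k≤f̂ : k ≤ℤ fhat f q i
      k≤f̂ = ℤP.≮⇒≥ λ f̂<k → ℤP.<⇒≱ k₁<f̂ (≤k₁ (fhat-∈ q i) f̂<k)

    -- Let i₀ be the first index in `Down`; it suffices that the threshold of some lower cover is
    -- exceeded at i₀. A label of p other than s exceeds s, and (p , s) serves. A label s is not
    -- lowerable, so a cover below p has a label of at least k, which exceeds the predecessor of k.
    down-attained : # down? ℓ ≡ 0 ⊎ ∃ λ z → z ⋖Γ (p , k) × # down? ℓ ≤ Φ f z
    down-attained with first-success down? ℓ
    ... | inj₁ none = inj₁ (#≡0 down? ℓ none)
    ... | inj₂ (i₀ , (x , ¬l) , before) = inj₂ (attained (fhat f p i₀ ℤP.≟ s))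
      where
      bound : ∀ {q k₁} → k₁ <ℤ fhat f q i₀ → # down? ℓ ≤ Φ f (q , k₁)
      bound {q} {k₁} k₁<f̂ = subst (# down? ℓ ≤_) (sym (Φ-# f q k₁))
        (#-mono down? (exceeds? f q k₁) ℓ λ 1≤i _ dn → ℤP.<-≤-trans k₁<f̂ (fhat-mono (before 1≤i dn)))
      attained : Dec (fhat f p i₀ ≡ s) → ∃ λ z → z ⋖Γ (p , k) × # down? ℓ ≤ Φ f z
      attained (no f̂≢s) = (p , s) , (R⊆Γ (proj₁ isSucc) , k∈Γ , inj₁ (refl , R̂-succ)) ,
        bound (ℤP.≤∧≢⇒< (X⇒s≤ i₀ x) (f̂≢s ∘ sym))
      attained (yes f̂≡s) with f̂≡⇒dom (proj₁ isSucc) f̂≡s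
      ... | d , f≡s with supporting-cover d f≡s (λ l → ¬l (d , f≡s , l))
      ...   | q , q⋖p , k≤f̂ with pred-exists (lo∈R̂ {q}) (lo<R q k∈)
      ...     | k₁ , isPred@(k₁∈ , k₁<k , _) = (q , k₁) ,
        ( (k₁∈ , k₁<hi) , k∈Γ , inj₂ (q⋖p , isPred , <hi⇒≢maxL q k₁<hi , maximal)) ,
        bound (ℤP.<-≤-trans k₁<k k≤f̂)
        where
        k₁<hi : k₁ <ℤ hi q
        k₁<hi = ℤP.<-trans k₁<k (R<hi q k∈)
        -- A larger j in `R̂ p` is at least s, so the label of q at i₀ lies strictly between k₁ and
        -- j, and k₁ is not the predecessor of j.
        maximal : ¬ Any (λ j → k <ℤ j × IsPred (toList (R̂ q)) j k₁) (toList (R̂ p))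
        maximal some with find some
        ... | j , j∈ , k<j , (_ , _ , ≤k₁) = ℤP.<⇒≱ (ℤP.<-≤-trans k₁<k k≤f̂)
          (≤k₁ (fhat-∈ q i₀) (ℤP.<-≤-trans (subst (fhat f q i₀ <ℤ_) f̂≡s (fhat-strict {i = i₀} (proj₁ q⋖p)))
                                           (proj₂ (proj₂ R̂-succ) j∈ k<j)))

    module _ {σ : QPart} (σ≈Φ : σ ≈Γ Φ f) where

      upperValue-# : upperValue σ p k ≡ # up? ℓ
      upperValue-# = minℕ-unique ℓ _ bound attained
        where
        bound : ∀ {x} → x ∈ map σ (filterᵇ (λ y → coverΓ (p , k) y) Γlist) → # up? ℓ ≤ x
        bound x∈ with ∈-map⁻ σ x∈
        ... | (q , k₂) , y∈ , refl with ∈-filterᵇ⁻ (coverΓ-reflects (p , k)) Γlist y∈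
        ...   | y∈Γ , c = subst (# up? ℓ ≤_) (sym (trans (σ≈Φ (∈-Γlist⁻ y∈Γ)) (Φ-# f q k₂)))
                            (#-mono up? (exceeds? f q k₂) ℓ λ _ _ → up-⊆ c)
        attained : ∃ λ x → x ∈ map σ (filterᵇ (λ y → coverΓ (p , k) y) Γlist) × x ≤ # up? ℓ
        attained with up-attained
        ... | y , c , Φ≤ = σ y , ∈-map⁺ σ (∈-filterᵇ⁺ (coverΓ-reflects (p , k)) (∈-Γlist⁺ y∈Γ) c)
                         , subst (_≤ # up? ℓ) (sym (σ≈Φ y∈Γ)) Φ≤
          where
          y∈Γ : InΓ y
          y∈Γ = proj₁ (proj₂ c)

      lowerValue-# : lowerValue σ p k ≡ # down? ℓ
      lowerValue-# = maxℕ-unique _ bound (attained down-attained)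
        where
        bound : ∀ {x} → x ∈ map σ (filterᵇ (λ z → coverΓ z (p , k)) Γlist) → x ≤ # down? ℓ
        bound x∈ with ∈-map⁻ σ x∈
        ... | (q , k₁) , z∈ , refl with ∈-filterᵇ⁻ (λ z → coverΓ-reflects z (p , k)) Γlist z∈
        ...   | z∈Γ , c = subst (_≤ # down? ℓ) (sym (trans (σ≈Φ (∈-Γlist⁻ z∈Γ)) (Φ-# f q k₁)))
                            (#-mono (exceeds? f q k₁) down? ℓ λ _ _ → down-⊇ c)
        attained : _ → # down? ℓ ≡ 0 ⊎ ∃ λ x → x ∈ map σ (filterᵇ (λ z → coverΓ z (p , k)) Γlist) × # down? ℓ ≤ x
        attained (inj₁ ≡0)           = inj₁ ≡0
        attained (inj₂ (z , c , ≤Φ)) = inj₂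
          ( σ z , ∈-map⁺ σ (∈-filterᵇ⁺ (λ z → coverΓ-reflects z (p , k)) (∈-Γlist⁺ (proj₁ c)) c)
          , subst (# down? ℓ ≤_) (sym (σ≈Φ (proj₁ c))) ≤Φ)

      -- The minimum over the upper covers is the old value plus a, so the truncated subtraction is
      -- exact.
      toggled-Φ : toggled σ p k ≡ Φ (ρ k f) (p , k)
      toggled-Φ = begin
        (upperValue σ p k + lowerValue σ p k) ∸ σ (p , k)
          ≡⟨ cong₂ _∸_ (cong₂ _+_ (trans upperValue-# #up) lowerValue-#) (trans (σ≈Φ k∈Γ) (Φ-# f p k)) ⟩
        (# x? ℓ + a + # down? ℓ) ∸ # x? ℓ    ≡⟨ cong (_∸ # x? ℓ) (ℕP.+-assoc (# x? ℓ) a _) ⟩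
        (# x? ℓ + (a + # down? ℓ)) ∸ # x? ℓ  ≡⟨ ℕP.m+n∸m≡n (# x? ℓ) _ ⟩
        a + # down? ℓ                        ≡⟨ #ρ ⟨
        # (exceeds? (ρ k f) p k) ℓ           ≡⟨ Φ-# (ρ k f) p k ⟨
        Φ (ρ k f) (p , k) ∎
        where open ≡-Reasoning

  cover-≢ : ∀ {p q j k} → (p , k) ⋖Γ (q , j) → j ≢ k
  cover-≢ (_ , _ , inj₁ (_ , _ , j<k , _)) refl = ℤP.<-irrefl refl j<k
  cover-≢ (_ , _ , inj₂ (_ , (_ , k<j , _) , _)) refl = ℤP.<-irrefl refl k<j

  -- Toggling a whole layer

  module ToggleLayer (k : ℤ) where

    actᵇ : Fin n → Bool
    actᵇ p = inΓ (p , k) ∧ not ⌊ k ℤP.≟ minStar p ⌋ ∧ not ⌊ k ℤP.≟ maxStar p ⌋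

    -- The boundary of Γ takes away just `lo p` and the maximum of `R p`, so the toggles in `τ k`
    -- act in the same fibres as `ρ k`.
    act-reflects : ∀ p → Reflects (Active k p) (actᵇ p)
    act-reflects p = reflects-map
      (inΓ-reflects (p , k) ×-reflects ¬-reflects (isYes-reflects (k ℤP.≟ minStar p))
        ×-reflects ¬-reflects (isYes-reflects (k ℤP.≟ maxStar p)))
      (λ ((k∈ , k<hi) , k≢min , k≢max) →
        R̂-interior k∈ (ℤP.≤∧≢⇒< (lo-≤ k∈) (λ e → k≢min (trans (sym e) (sym (minStar-lo p))))) k<hi ,
        λ e → k≢max (trans e (sym (maxStar-maxL p))))
      (λ (k∈ , k≢max) → R⊆Γ k∈ ,
        (λ e → ℤP.<-irrefl (sym (trans e (minStar-lo p))) (lo<R p k∈)) ,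
        (λ e → k≢max (trans e (maxStar-maxL p))))

    layer : Fin n → QPart → QPart
    layer p σ = if actᵇ p then toggle (p , k) σ else σ

    layers : List (Fin n) → QPart → QPart
    layers ps σ = foldr layer σ ps

    layer-off : ∀ p σ {q j} → ¬ (q ≡ p × j ≡ k) → layer p σ (q , j) ≡ σ (q , j)
    layer-off p σ {q} {j} ≢ with actᵇ p
    ... | false = refl
    ... | true  = if-no (isYes-reflects (q FinP.≟ p) ×-reflects isYes-reflects (j ℤP.≟ k)) ≢

    layer-at : ∀ p σ → layer p σ (p , k) ≡ (if actᵇ p then toggled σ p k else σ (p , k))
    layer-at p σ with actᵇ p
    ... | false = refl
    ... | true  = if-yes (isYes-reflects (p FinP.≟ p) ×-reflects isYes-reflects (k ℤP.≟ k)) (refl , refl)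

    layers-off : ∀ ps σ {q j} → j ≢ k → layers ps σ (q , j) ≡ σ (q , j)
    layers-off []       σ j≢k = refl
    layers-off (p ∷ ps) σ j≢k = trans (layer-off p (layers ps σ) (j≢k ∘ proj₂)) (layers-off ps σ j≢k)

    layers-∉ : ∀ ps σ {q} → q ∉ ps → layers ps σ (q , k) ≡ σ (q , k)
    layers-∉ []       σ q∉ = refl
    layers-∉ (p ∷ ps) σ q∉ = trans (layer-off p (layers ps σ) (q∉ ∘ here ∘ proj₁)) (layers-∉ ps σ (q∉ ∘ there))

    -- No two elements (p , k), (q , k) of a layer are related by a cover, so toggles in it do not interact.
    toggled-cong : ∀ {σ σ′} p → (∀ {q j} → j ≢ k → σ (q , j) ≡ σ′ (q , j)) → σ (p , k) ≡ σ′ (p , k) →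
      toggled σ p k ≡ toggled σ′ p k
    toggled-cong {σ} {σ′} p off at = cong₂ _∸_ (cong₂ _+_ (cong (minℕ ℓ) above) (cong maxℕ below)) at
      where
      above : map σ (filterᵇ (λ y → coverΓ (p , k) y) Γlist) ≡ map σ′ (filterᵇ (λ y → coverΓ (p , k) y) Γlist)
      above = ListP.map-cong-local (All.tabulate λ {(q , j)} y∈ →
        off (cover-≢ (proj₂ (∈-filterᵇ⁻ (coverΓ-reflects (p , k)) Γlist y∈))))
      below : map σ (filterᵇ (λ z → coverΓ z (p , k)) Γlist) ≡ map σ′ (filterᵇ (λ z → coverΓ z (p , k)) Γlist)
      below = ListP.map-cong-local (All.tabulate λ {(q , j)} z∈ →
        off (cover-≢ (proj₂ (∈-filterᵇ⁻ (λ z → coverΓ-reflects z (p , k)) Γlist z∈)) ∘ sym))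

    -- The list has no repetitions, so each element is toggled once, and its new value may be
    -- computed from the initial σ.
    layers-∈ : ∀ ps σ {q} → Unique ps → q ∈ ps →
      layers ps σ (q , k) ≡ (if actᵇ q then toggled σ q k else σ (q , k))
    layers-∈ (p ∷ ps) σ (p∉ ∷ _) (here refl) = trans (layer-at p (layers ps σ))
      (cong₂ (λ x y → if actᵇ p then x else y) (toggled-cong p (layers-off ps σ) at) at)
      where
      at : layers ps σ (p , k) ≡ σ (p , k)
      at = layers-∉ ps σ (λ p∈ → All.lookup p∉ p∈ refl)
    layers-∈ (p ∷ ps) σ {q} (p∉ ∷ uniq) (there q∈) =
      trans (layer-off p (layers ps σ) (λ (q≡p , _) → All.lookup p∉ q∈ (sym q≡p))) (layers-∈ ps σ uniq q∈)

    τ-off : ∀ σ {q j} → j ≢ k → τ k σ (q , j) ≡ σ (q , j)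
    τ-off σ = layers-off (allFin n) σ

    τ-at : ∀ σ q → τ k σ (q , k) ≡ (if actᵇ q then toggled σ q k else σ (q , k))
    τ-at σ q = layers-∈ (allFin n) σ (allFin⁺ n) (∈-allFin q)

    τ-trivial : ∀ σ → (∀ p → k ∉ toList (R p)) → ∀ x → τ k σ x ≡ σ x
    τ-trivial σ k∉ (q , j) with j ℤP.≟ k
    ... | no j≢k   = τ-off σ j≢k
    ... | yes refl = trans (τ-at σ q) (if-no (act-reflects q) (k∉ q ∘ proj₁))

    τ-Φ : ∀ {f σ} → IsLabeling S f → σ ≈Γ Φ f → τ k σ ≈Γ Φ (ρ k f)
    τ-Φ {f} {σ} lf σ≈Φ {q , j} x∈ with j ℤP.≟ k
    ... | no j≢k = trans (τ-off σ j≢k) (trans (σ≈Φ x∈) (sym (Φ-ρ-off lf k x∈ j≢k)))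
    ... | yes refl with active? k q
    ...   | no ¬act = trans (trans (τ-at σ q) (if-no (act-reflects q) ¬act))
                            (trans (σ≈Φ x∈) (sym (Φ-ρ-inactive f ¬act)))
    ...   | yes act = trans (trans (τ-at σ q) (if-yes (act-reflects q) act))
                            (ActiveFibre.toggled-Φ lf (proj₁ act) (proj₂ (active⇒succ act)) σ≈Φ)

  -- Composition over all layers

  τs-Φ : ∀ t k {f σ} → IsLabeling S f → σ ≈Γ Φ f → τs k t σ ≈Γ Φ (ρs k t f)
  τs-Φ zero    k lf σ≈Φ = σ≈Φ
  τs-Φ (suc t) k lf σ≈Φ = τs-Φ t (k ℤ.+ + 1) (ρ-labeling lf k) (ToggleLayer.τ-Φ k lf σ≈Φ)

  [k+1]+i : ∀ k i → (k ℤ.+ + 1) ℤ.+ + i ≡ k ℤ.+ + suc i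
  [k+1]+i k i = ℤP.+-assoc k (+ 1) (+ i)

  τs-trivial : ∀ t k σ → (∀ {i} → i < t → ∀ p → k ℤ.+ + i ∉ toList (R p)) → ∀ x → τs k t σ x ≡ σ x
  τs-trivial zero    k σ k∉ x = refl
  τs-trivial (suc t) k σ k∉ x = trans
    (τs-trivial t (k ℤ.+ + 1) (τ k σ) (λ {i} i<t p → k∉ (s≤s i<t) p ∘ subst (_∈ toList (R p)) ([k+1]+i k i)) x)
    (ToggleLayer.τ-trivial k σ (λ p → k∉ (s≤s z≤n) p ∘ subst (_∈ toList (R p)) (sym (ℤP.+-identityʳ k))) x)

  τs-+ : ∀ t₁ t₂ k σ → τs k (t₁ + t₂) σ ≡ τs (k ℤ.+ + t₁) t₂ (τs k t₁ σ)
  τs-+ zero     t₂ k σ = cong (λ j → τs j t₂ σ) (sym (ℤP.+-identityʳ k))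
  τs-+ (suc t₁) t₂ k σ = trans (τs-+ t₁ t₂ (k ℤ.+ + 1) (τ k σ))
    (cong (λ j → τs j t₂ (τs (k ℤ.+ + 1) t₁ (τ k σ))) ([k+1]+i k t₁))

  -- TogPro toggles the layers minAll ‥ maxAll of R̂; those outside minR ‥ maxR carry no active element.
  TogPro-Φ : ∀ {f} → IsLabeling S f → Φ (Pro f) ≈Γ TogPro (Φ f)
  TogPro-Φ {f} lf {x@(p , _)} x∈ = sym (begin
    TogPro (Φ f) x                                       ≡⟨ cong (λ t → τs minAll t (Φ f) x) total ⟩
    τs minAll (t₁ + (t₂ + t₃)) (Φ f) x                   ≡⟨ cong (λ σ → σ x) (τs-+ t₁ (t₂ + t₃) minAll (Φ f)) ⟩
    τs (minAll ℤ.+ + t₁) (t₂ + t₃) σ₁ x                  ≡⟨ cong (λ k → τs k (t₂ + t₃) σ₁ x) minAll+t₁ ⟩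
    τs minR (t₂ + t₃) σ₁ x                               ≡⟨ cong (λ σ → σ x) (τs-+ t₂ t₃ minR σ₁) ⟩
    τs (minR ℤ.+ + t₂) t₃ (τs minR t₂ σ₁) x              ≡⟨ τs-trivial t₃ (minR ℤ.+ + t₂) (τs minR t₂ σ₁) above x ⟩
    τs minR t₂ σ₁ x                                      ≡⟨ τs-Φ t₂ minR lf (λ {y} _ → τs-trivial t₁ minAll (Φ f) below y) x∈ ⟩
    Φ (Pro f) x                                          ∎)
    where
    open ≡-Reasoning
    -- The point x supplies an element of P, so the fallback 0 of `minR` and `maxR` is not met.
    head∈ : List⁺.head (R p) ∈ toList (R p)
    head∈ = here refl
    minAll≤minR : minAll ≤ℤ minR
    minAll≤minR = ℤP.≤-trans (minAll-≤ R̂ (lo∈R̂ {p})) (ℤP.<⇒≤ (lo<minR p))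
    minR≤maxR : minR ≤ℤ maxR
    minR≤maxR = ℤP.≤-trans (minAll-≤ R {p} head∈) (≤-maxAll R {p} head∈)
    maxR≤maxAll : maxR ≤ℤ maxAll
    maxR≤maxAll = ℤP.≤-trans (ℤP.<⇒≤ (maxR<hi p)) (≤-maxAll R̂ (hi∈R̂ {p}))
    -- There are t₁ layers below `minR`, t₃ above `maxR`, and t₂ from `minR` to `maxR` inclusive,
    -- whence the `suc`.
    t₁ d t₂ t₃ : ℕ
    t₁ = ℤ.∣ minR ℤ.- minAll ∣
    d  = ℤ.∣ maxR ℤ.- minR ∣
    t₂ = suc d
    t₃ = ℤ.∣ maxAll ℤ.- maxR ∣
    σ₁ : QPart
    σ₁ = τs minAll t₁ (Φ f)
    minAll+t₁ : minAll ℤ.+ + t₁ ≡ minR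
    minAll+t₁ = i+∣j-i∣≡j minAll≤minR
    minR+t₂ : minR ℤ.+ + t₂ ≡ ℤ.suc maxR
    minR+t₂ = trans (sym ([k+1]+i minR d)) (trans (cong (ℤ._+ + d) (ℤP.+-comm minR (+ 1)))
      (trans (ℤP.+-assoc (+ 1) minR (+ d)) (cong ℤ.suc (i+∣j-i∣≡j minR≤maxR))))
    sum : t₁ + (d + t₃) ≡ ℤ.∣ maxAll ℤ.- minAll ∣
    sum = ℤP.+-injective (∙-cancelˡ minAll _ _ (begin
      minAll ℤ.+ + (t₁ + (d + t₃))                 ≡⟨ ℤP.+-assoc minAll (+ t₁) (+ (d + t₃)) ⟨
      (minAll ℤ.+ + t₁) ℤ.+ + (d + t₃)             ≡⟨ cong (ℤ._+ + (d + t₃)) minAll+t₁ ⟩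
      minR ℤ.+ + (d + t₃)                          ≡⟨ ℤP.+-assoc minR (+ d) (+ t₃) ⟨
      (minR ℤ.+ + d) ℤ.+ + t₃                      ≡⟨ cong (ℤ._+ + t₃) (i+∣j-i∣≡j minR≤maxR) ⟩
      maxR ℤ.+ + t₃                                ≡⟨ i+∣j-i∣≡j maxR≤maxAll ⟩
      maxAll                                       ≡⟨ i+∣j-i∣≡j (ℤP.≤-trans minAll≤minR (ℤP.≤-trans minR≤maxR maxR≤maxAll)) ⟨
      minAll ℤ.+ + ℤ.∣ maxAll ℤ.- minAll ∣         ∎))
    total : suc ℤ.∣ maxAll ℤ.- minAll ∣ ≡ t₁ + (t₂ + t₃)
    total = trans (cong suc (sym sum)) (sym (ℕP.+-suc t₁ (d + t₃)))
    below : ∀ {i} → i < t₁ → ∀ q → minAll ℤ.+ + i ∉ toList (R q)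
    below {i} i<t₁ q ∈R = ℤP.<⇒≱ (subst (minAll ℤ.+ + i <ℤ_) minAll+t₁ (ℤP.+-monoʳ-< minAll (ℤ.+<+ i<t₁))) (minAll-≤ R ∈R)
    above : ∀ {i} → i < t₃ → ∀ q → minR ℤ.+ + t₂ ℤ.+ + i ∉ toList (R q)
    above {i} _ q ∈R = ℤP.<⇒≱ (ℤP.suc[i]≤j⇒i<j (ℤP.≤-trans (ℤP.≤-reflexive (sym minR+t₂)) (ℤP.i≤i+j _ (+ i))))
                              (≤-maxAll R ∈R)

theorem2p8 : (S : Setting) → let open Setting S in
  1 ≤ ℓ →
  (∀ p → u p + v p ≤ ℓ) →
  (∀ p₁ p₂ → p₁ ≤P p₂ → v p₁ ≤ v p₂ × u p₂ ≤ u p₁) →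
  Consistent S →
  (h h̃ : Fin n → ℕ) → (∀ p → IsHeight S p (h p)) → (∀ p → IsCoheight S p (h̃ p)) →
  (raise? : ∀ f p i → Dec (Raisable S f p i)) →
  (lower? : ∀ f p i → Dec (Lowerable S f p i)) →
  let open Hat S h h̃
      open Promotion S raise? lower?
  in
  -- Φ maps 𝓛 into 𝓐^{B̂}(Γ(P,R̂))
  (∀ f → IsLabeling S f → InA (Φ f)) ×
  -- Φ is injective on 𝓛 (labelings compared on P × [ℓ]^v_u)
  (∀ f g → IsLabeling S f → IsLabeling S g →
     (∀ x → T (inΓ x) → Φ f x ≡ Φ g x) →
     ∀ p i → InDom S p i → f p i ≡ g p i) ×
  -- Φ is onto 𝓐^{B̂}(Γ(P,R̂)) (Q-partitions compared on Γ(P,R̂))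
  (∀ σ → InA σ → ∃ λ f → IsLabeling S f × (∀ x → T (inΓ x) → Φ f x ≡ σ x)) ×
  -- equivariance
  (∀ f → IsLabeling S f → ∀ x → T (inΓ x) → Φ (Pro f) x ≡ TogPro (Φ f) x)
theorem2p8 S _ u+v≤ℓ uv-mono _ h h̃ isHeight isCoheight raise? lower? =
  (λ f lf → Φ-InA lf) ,
  (λ f g lf lg Φf≡Φg p i d →
    ℤP.≤-antisym (Φ-injective-≤ lg lf (λ x x∈ → sym (Φf≡Φg x x∈)) d) (Φ-injective-≤ lf lg Φf≡Φg d)) ,
  (λ σ σ∈A → let open Surjectivity σ∈A in F , F-labeling , λ x x∈ → Φ-F (T⇒ (inΓ-reflects x) x∈)) ,
  (λ f lf x x∈ → TogPro-Φ lf (T⇒ (inΓ-reflects x) x∈))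
  where
  open Equivariance S h h̃ isHeight isCoheight u+v≤ℓ uv-mono raise? lower?
  open Hat S h h̃ using (inΓ)
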